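{- Let $r, m, N$ be positive integers. If \[ N \ge \prod_{k=1}^r \left(1 + 2 k^{1/m}\right) \] and $\{1, \dots, N\}$ is colored using $r$ colors, then there exists a monochromatic solution to the equation \[ x_1+\cdots+x_{m+1}=y_1+\cdots+y_m . \]
   Context: A coloring of $\{1,\dots,N\}$ using $r$ colors is a function $\phi:\{1,\dots,N\}\to\{1,\dots,r\}$. A monochromatic solution to the equation is a choice of $x_1,\dots,x_{m+1},y_1,\dots,y_m\in\{1,\dots,N\}$ satisfying it, all having the same color under $\phi$; the variables in a solution are allowed to repeat (they need not be distinct). -}

module Defs where

open import Data.Nat.Base as ℕ using (ℕ; zero; suc; NonZero)
import Data.Nat.Properties as ℕ
open import Data.Integer.Base as ℤ using (+_; +[1+_])
import Data.Integer.Properties as ℤ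
open import Data.Rational.Base as ℚ using (ℚ; 0ℚ; 1ℚ; ½; mkℚ; ∣_∣; toℚᵘ)
  renaming (_≤_ to _≤ℚ_; _<_ to _<ℚ_; _+_ to _+ℚ_; _-_ to _-ℚ_; _*_ to _*ℚ_; -_ to -ℚ_)
import Data.Rational.Properties as ℚ
import Data.Rational.Unnormalised.Base as ℚᵘ
import Data.Rational.Unnormalised.Properties as ℚᵘ
open import Data.Rational.Solver using (module +-*-Solver)
open import Data.Fin.Base using (Fin; toℕ)
open import Data.Product using (∃; ∃₂; _×_; _,_; proj₁; proj₂)
open import Data.Sum.Base using (inj₁; inj₂)
open import Relation.Nullary.Decidable using (yes; no)
open import Relation.Binary.PropositionalEquality
  using (_≡_; refl; sym; trans; cong; cong₂; subst; subst₂; module ≡-Reasoning)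
open import Algebra.Properties.Monoid.Sum ℕ.+-0-monoid using (sum)

-- Equivalently, x and y are Cauchy sequences with the same limit; Near x x says that x is Cauchy.
Near : (ℕ → ℚ) → (ℕ → ℚ) → Set
Near x y = ∀ ε → 0ℚ <ℚ ε → ∃ λ M → ∀ i j → M ℕ.≤ i → M ℕ.≤ j → ∣ x i -ℚ y j ∣ ≤ℚ ε

Cauchy : (ℕ → ℚ) → Set
Cauchy x = Near x x

record ℝ : Set where
  constructor mkℝ
  field
    seq    : ℕ → ℚ
    cauchy : Cauchy seq

open ℝ public

infix 4 _≤_ _≥_ _≃_

_≤_ : ℝ → ℝ → Set
x ≤ y = ∀ ε → 0ℚ <ℚ ε → ∃ λ M → ∀ n → M ℕ.≤ n → seq x n ≤ℚ seq y n +ℚ ε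

_≥_ : ℝ → ℝ → Set
x ≥ y = y ≤ x

_≃_ : ℝ → ℝ → Set
x ≃ y = x ≤ y × y ≤ x

0<½* : ∀ {ε} → 0ℚ <ℚ ε → 0ℚ <ℚ ½ *ℚ ε
0<½* {ε} 0<ε = subst (_<ℚ ½ *ℚ ε) (ℚ.*-zeroʳ ½) (ℚ.*-monoʳ-<-pos ½ 0<ε)

½*+½* : ∀ ε → ½ *ℚ ε +ℚ ½ *ℚ ε ≡ ε
½*+½* ε = trans (sym (ℚ.*-distribʳ-+ ε ½ ½)) (ℚ.*-identityˡ ε)

near-const : ∀ q → Near (λ _ → q) (λ _ → q)
near-const q ε 0<ε = 0 , λ _ _ _ _ →
  subst (_≤ℚ ε) (sym (cong ∣_∣ (ℚ.+-inverseʳ q))) (ℚ.<⇒≤ 0<ε)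

near-+ : ∀ x y u v → Near x y → Near u v →
         Near (λ n → x n +ℚ u n) (λ n → y n +ℚ v n)
near-+ x y u v p q ε 0<ε with p (½ *ℚ ε) (0<½* 0<ε) | q (½ *ℚ ε) (0<½* 0<ε)
... | M , f | K , g = M ℕ.⊔ K , λ i j Mi Mj → begin
    ∣ (x i +ℚ u i) -ℚ (y j +ℚ v j) ∣
      ≡⟨ cong ∣_∣ (solve 4 (λ a b c d → (a :+ b) :- (c :+ d) := (a :- c) :+ (b :- d))
                     refl (x i) (u i) (y j) (v j)) ⟩
    ∣ (x i -ℚ y j) +ℚ (u i -ℚ v j) ∣
      ≤⟨ ℚ.∣p+q∣≤∣p∣+∣q∣ (x i -ℚ y j) (u i -ℚ v j) ⟩
    ∣ x i -ℚ y j ∣ +ℚ ∣ u i -ℚ v j ∣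
      ≤⟨ ℚ.+-mono-≤ (f i j (ℕ.m⊔n≤o⇒m≤o M K Mi) (ℕ.m⊔n≤o⇒m≤o M K Mj))
                    (g i j (ℕ.m⊔n≤o⇒n≤o M K Mi) (ℕ.m⊔n≤o⇒n≤o M K Mj)) ⟩
    ½ *ℚ ε +ℚ ½ *ℚ ε
      ≡⟨ ½*+½* ε ⟩
    ε ∎
  where
  open ℚ.≤-Reasoning
  open +-*-Solver

near-sym : ∀ x y → Near x y → Near y x
near-sym x y p ε 0<ε with p ε 0<ε
... | M , f = M , λ i j Mi Mj →
  subst (_≤ℚ ε)
    (trans (sym (ℚ.∣-p∣≡∣p∣ (x j -ℚ y i)))
           (cong ∣_∣ (solve 2 (λ a b → :- (a :- b) := b :- a) refl (x j) (y i))))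
    (f j i Mj Mi)
  where open +-*-Solver

near⇒bounded : ∀ x y → Near x y →
               ∃₂ λ B M → ℚ.Positive B × (∀ i → M ℕ.≤ i → ∣ x i ∣ ≤ℚ B)
near⇒bounded x y p with p 1ℚ (ℚ.positive⁻¹ 1ℚ)
... | M , f = 1ℚ +ℚ ∣ y M ∣ , M , ℚ.pos+nonNeg⇒pos 1ℚ ∣ y M ∣ {{ℚ.∣-∣-nonNeg (y M)}} , λ i Mi → begin
    ∣ x i ∣                     ≡⟨ cong ∣_∣ (solve 2 (λ a b → a := (a :- b) :+ b) refl (x i) (y M)) ⟩
    ∣ (x i -ℚ y M) +ℚ y M ∣     ≤⟨ ℚ.∣p+q∣≤∣p∣+∣q∣ (x i -ℚ y M) (y M) ⟩
    ∣ x i -ℚ y M ∣ +ℚ ∣ y M ∣   ≤⟨ ℚ.+-monoˡ-≤ ∣ y M ∣ (f i M Mi ℕ.≤-refl) ⟩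
    1ℚ +ℚ ∣ y M ∣               ∎
  where
  open ℚ.≤-Reasoning
  open +-*-Solver

half-over : ∀ B ε → ℚ.Positive B → 0ℚ <ℚ ε → ∃ λ δ → 0ℚ <ℚ δ × B *ℚ δ ≡ ½ *ℚ ε
half-over B ε B>0 0<ε = 1/B *ℚ (½ *ℚ ε) , 0<δ ,
  trans (sym (ℚ.*-assoc B 1/B (½ *ℚ ε)))
        (trans (cong (_*ℚ (½ *ℚ ε)) (ℚ.*-inverseʳ B)) (ℚ.*-identityˡ _))
  where
  instance
    _ = B>0
    _ = ℚ.pos⇒nonZero B
  1/B = ℚ.1/ B
  0<δ = subst (_<ℚ 1/B *ℚ (½ *ℚ ε)) (ℚ.*-zeroʳ 1/B)
          (ℚ.*-monoʳ-<-pos 1/B {{ℚ.1/pos⇒pos B}} (0<½* 0<ε))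

∣*-*∣≤ : ∀ a b c d → ∣ a *ℚ b -ℚ c *ℚ d ∣ ≤ℚ ∣ a ∣ *ℚ ∣ b -ℚ d ∣ +ℚ ∣ d ∣ *ℚ ∣ a -ℚ c ∣
∣*-*∣≤ a b c d = begin
  ∣ a *ℚ b -ℚ c *ℚ d ∣
    ≡⟨ cong ∣_∣ (solve 4 (λ a b c d → a :* b :- c :* d := a :* (b :- d) :+ d :* (a :- c))
                   refl a b c d) ⟩
  ∣ a *ℚ (b -ℚ d) +ℚ d *ℚ (a -ℚ c) ∣
    ≤⟨ ℚ.∣p+q∣≤∣p∣+∣q∣ (a *ℚ (b -ℚ d)) (d *ℚ (a -ℚ c)) ⟩
  ∣ a *ℚ (b -ℚ d) ∣ +ℚ ∣ d *ℚ (a -ℚ c) ∣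
    ≡⟨ cong₂ _+ℚ_ (ℚ.∣p*q∣≡∣p∣*∣q∣ a (b -ℚ d)) (ℚ.∣p*q∣≡∣p∣*∣q∣ d (a -ℚ c)) ⟩
  ∣ a ∣ *ℚ ∣ b -ℚ d ∣ +ℚ ∣ d ∣ *ℚ ∣ a -ℚ c ∣ ∎
  where
  open ℚ.≤-Reasoning
  open +-*-Solver

∣∣*∣∣-mono : ∀ a D b d → ℚ.Positive D → ∣ a ∣ ≤ℚ D → ∣ b ∣ ≤ℚ d → ∣ a ∣ *ℚ ∣ b ∣ ≤ℚ D *ℚ d
∣∣*∣∣-mono a D b d D>0 a≤D b≤d = ℚ.≤-trans
  (ℚ.*-monoʳ-≤-nonNeg ∣ b ∣ {{ℚ.∣-∣-nonNeg b}} a≤D)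
  (ℚ.*-monoˡ-≤-nonNeg D {{ℚ.pos⇒nonNeg D {{D>0}}}} b≤d)

near-* : ∀ x y u v → Near x y → Near u v →
         Near (λ n → x n *ℚ u n) (λ n → y n *ℚ v n)
near-* x y u v p q ε 0<ε =
  let B , M₁ , B>0 , b = near⇒bounded x y p
      C , M₂ , C>0 , c = near⇒bounded v u (near-sym u v q)
      δ , 0<δ , Bδ     = half-over B ε B>0 0<ε
      η , 0<η , Cη     = half-over C ε C>0 0<ε
      M₃ , f           = q δ 0<δ
      M₄ , g           = p η 0<η
      M₁₂              = M₁ ℕ.⊔ M₂
      M₃₄              = M₃ ℕ.⊔ M₄
  in M₁₂ ℕ.⊔ M₃₄ , λ i j Mi Mj →
    let i₁₂ = ℕ.m⊔n≤o⇒m≤o M₁₂ M₃₄ Mi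
        i₃₄ = ℕ.m⊔n≤o⇒n≤o M₁₂ M₃₄ Mi
        j₁₂ = ℕ.m⊔n≤o⇒m≤o M₁₂ M₃₄ Mj
        j₃₄ = ℕ.m⊔n≤o⇒n≤o M₁₂ M₃₄ Mj
    in ℚ.≤-trans (∣*-*∣≤ (x i) (u i) (y j) (v j))
      (ℚ.≤-trans
        (ℚ.+-mono-≤
          (∣∣*∣∣-mono (x i) B (u i -ℚ v j) δ B>0 (b i (ℕ.m⊔n≤o⇒m≤o M₁ M₂ i₁₂))
            (f i j (ℕ.m⊔n≤o⇒m≤o M₃ M₄ i₃₄) (ℕ.m⊔n≤o⇒m≤o M₃ M₄ j₃₄)))
          (∣∣*∣∣-mono (v j) C (x i -ℚ y j) η C>0 (c j (ℕ.m⊔n≤o⇒n≤o M₁ M₂ j₁₂))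
            (g i j (ℕ.m⊔n≤o⇒n≤o M₃ M₄ i₃₄) (ℕ.m⊔n≤o⇒n≤o M₃ M₄ j₃₄))))
        (ℚ.≤-reflexive (trans (cong₂ _+ℚ_ Bδ Cη) (½*+½* ε))))

infixl 6 _+_
infixl 7 _*_
infixr 8 _^_

_+_ : ℝ → ℝ → ℝ
x + y = mkℝ (λ n → seq x n +ℚ seq y n) (near-+ (seq x) (seq x) (seq y) (seq y) (cauchy x) (cauchy y))

_*_ : ℝ → ℝ → ℝ
x * y = mkℝ (λ n → seq x n *ℚ seq y n) (near-* (seq x) (seq x) (seq y) (seq y) (cauchy x) (cauchy y))

fromℚ : ℚ → ℝ
fromℚ q = mkℝ (λ _ → q) (near-const q)

fromℕ : ℕ → ℝ
fromℕ n = fromℚ (+ n ℚ./ 1)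

_^_ : ℝ → ℕ → ℝ
x ^ zero  = fromℕ 1
x ^ suc m = x * x ^ m

∏₁ : ℕ → (ℕ → ℝ) → ℝ
∏₁ zero    f = fromℕ 1
∏₁ (suc r) f = ∏₁ r f * f (suc r)

syntax ∏₁ r (λ k → e) = ∏[1≤ k ≤ r ] e

floor-root : ∀ m .{{_ : NonZero m}} K → ∃ λ a → a ℕ.^ m ℕ.≤ K × K ℕ.< suc a ℕ.^ m
floor-root m@(suc m-1) K = search K (ℕ.m≤m*n (suc K) (suc K ℕ.^ m-1) {{ℕ.m^n≢0 (suc K) m-1}})
  where
  search : ∀ c → K ℕ.< suc c ℕ.^ m → ∃ λ a → a ℕ.^ m ℕ.≤ K × K ℕ.< suc a ℕ.^ m
  search zero    K< = 0 , ℕ.z≤n , K<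
  search (suc c) K< with suc c ℕ.^ m ℕ.≤? K
  ... | yes c≤K = suc c , c≤K , K<
  ... | no  c≰K = search c (ℕ.≰⇒> c≰K)

1/suc : ℕ → ℚ
1/suc n = + 1 ℚ./ suc n

frac-≤ : ∀ a d b e → a ℕ.* suc e ℕ.≤ b ℕ.* suc d → + a ℚ./ suc d ≤ℚ + b ℚ./ suc e
frac-≤ a d b e h = ℚ.toℚᵘ-cancel-≤
  (ℚᵘ.≤-trans (ℚᵘ.≤-reflexive (ℚ.toℚᵘ-fromℚᵘ (ℚᵘ.mkℚᵘ (+ a) d)))
    (ℚᵘ.≤-trans
      (ℚᵘ.*≤* (subst₂ ℤ._≤_ (ℤ.pos-* a (suc e)) (ℤ.pos-* b (suc d)) (ℤ.+≤+ h)))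
      (ℚᵘ.≤-reflexive (ℚᵘ.≃-sym (ℚ.toℚᵘ-fromℚᵘ (ℚᵘ.mkℚᵘ (+ b) e))))))

frac-suc : ∀ a d → + suc a ℚ./ suc d ≡ + a ℚ./ suc d +ℚ 1/suc d
frac-suc a d = ℚ.toℚᵘ-injective
  (ℚᵘ.≃-trans (ℚ.toℚᵘ-fromℚᵘ (ℚᵘ.mkℚᵘ (+ suc a) d))
  (ℚᵘ.≃-trans (ℚᵘ.*≡* eq)
  (ℚᵘ.≃-trans (ℚᵘ.+-cong (ℚᵘ.≃-sym (ℚ.toℚᵘ-fromℚᵘ (ℚᵘ.mkℚᵘ (+ a) d)))
                         (ℚᵘ.≃-sym (ℚ.toℚᵘ-fromℚᵘ (ℚᵘ.mkℚᵘ (+ 1) d))))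
              (ℚᵘ.≃-sym (ℚ.toℚᵘ-homo-+ (+ a ℚ./ suc d) (1/suc d))))))
  where
  D = + suc d
  eq : + suc a ℤ.* (D ℤ.* D) ≡ (+ a ℤ.* D ℤ.+ + 1 ℤ.* D) ℤ.* D
  eq = trans (sym (ℤ.*-assoc (+ suc a) D D))
             (cong (ℤ._* D) (trans (cong (ℤ._* D) (trans (cong +_ (ℕ.+-comm 1 a)) (ℤ.pos-+ a 1)))
                                   (ℤ.*-distribʳ-+ D (+ a) (+ 1))))

archimedean : ∀ ε → 0ℚ <ℚ ε → ∃ λ M → ∀ n → M ℕ.≤ n → 1/suc n ≤ℚ ε
archimedean (mkℚ (+ 0) d c) (ℚ.*<* (ℤ.+<+ ()))
archimedean ε@(mkℚ +[1+ p ] d c) _ = d , λ n d≤n →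
  subst (1/suc n ≤ℚ_) (ℚ.fromℚᵘ-toℚᵘ ε)
    (frac-≤ 1 n (suc p) d
      (ℕ.*-mono-≤ {1} {suc p} {suc d} {suc n} (ℕ.s≤s ℕ.z≤n) (ℕ.s≤s d≤n)))
archimedean (mkℚ (ℤ.-[1+ p ]) d c) (ℚ.*<* ())

module _ (m : ℕ) .{{_ : NonZero m}} (k : ℕ) where

  root-num : ℕ → ℕ
  root-num n = proj₁ (floor-root m (k ℕ.* suc n ℕ.^ m))

  root-num-≤ : ∀ n → root-num n ℕ.^ m ℕ.≤ k ℕ.* suc n ℕ.^ m
  root-num-≤ n = proj₁ (proj₂ (floor-root m (k ℕ.* suc n ℕ.^ m)))

  root-num-< : ∀ n → k ℕ.* suc n ℕ.^ m ℕ.< suc (root-num n) ℕ.^ m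
  root-num-< n = proj₂ (proj₂ (floor-root m (k ℕ.* suc n ℕ.^ m)))

  -- With d = n + 1, this is the largest multiple of 1/d whose m-th power is at most k.
  root-seq : ℕ → ℚ
  root-seq n = + root-num n ℚ./ suc n

  private
    *-^ : ∀ a b n → (a ℕ.* b) ℕ.^ n ≡ a ℕ.^ n ℕ.* b ℕ.^ n
    *-^ a b zero    = refl
    *-^ a b (suc n) = trans (cong (a ℕ.* b ℕ.*_) (*-^ a b n))
                            (ℕ.[m*n]*[o*p]≡[m*o]*[n*p] a b (a ℕ.^ n) (b ℕ.^ n))

    *-^-<⁻¹ : ∀ {a b} → a ℕ.^ m ℕ.< b ℕ.^ m → a ℕ.≤ b
    *-^-<⁻¹ {a} {b} h with ℕ.≤-total a b
    ... | inj₁ a≤b = a≤b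
    ... | inj₂ b≤a with () ← ℕ.<⇒≱ h (ℕ.^-monoˡ-≤ m b≤a)

    cross : ∀ i j → root-num i ℕ.* suc j ℕ.≤ suc (root-num j) ℕ.* suc i
    cross i j = *-^-<⁻¹ (begin-strict
      (root-num i ℕ.* suc j) ℕ.^ m             ≡⟨ *-^ (root-num i) (suc j) m ⟩
      root-num i ℕ.^ m ℕ.* J                   ≤⟨ ℕ.*-monoˡ-≤ J (root-num-≤ i) ⟩
      k ℕ.* I ℕ.* J                            ≡⟨ trans (ℕ.*-assoc k I J) (trans (cong (k ℕ.*_) (ℕ.*-comm I J)) (sym (ℕ.*-assoc k J I))) ⟩
      k ℕ.* J ℕ.* I                            <⟨ ℕ.*-monoˡ-< I {{ℕ.m^n≢0 (suc i) m}} (root-num-< j) ⟩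
      suc (root-num j) ℕ.^ m ℕ.* I             ≡⟨ *-^ (suc (root-num j)) (suc i) m ⟨
      (suc (root-num j) ℕ.* suc i) ℕ.^ m       ∎)
      where
      open ℕ.≤-Reasoning
      I = suc i ℕ.^ m
      J = suc j ℕ.^ m

  root-seq-≤ : ∀ i j → root-seq i ≤ℚ root-seq j +ℚ 1/suc j
  root-seq-≤ i j = subst (root-seq i ≤ℚ_) (frac-suc (root-num j) j)
    (frac-≤ (root-num i) i (suc (root-num j)) j (cross i j))

  private
    sub-≤ : ∀ {a b c} → a ≤ℚ b +ℚ c → a -ℚ b ≤ℚ c
    sub-≤ {a} {b} {c} h = subst (a -ℚ b ≤ℚ_)
      (solve 2 (λ b c → (b :+ c) :- b := c) refl b c) (ℚ.+-monoˡ-≤ (-ℚ b) h)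
      where open +-*-Solver

  root-cauchy : Cauchy root-seq
  root-cauchy ε 0<ε with archimedean ε 0<ε
  ... | M , f = M , bound
    where
    open +-*-Solver
    bound : ∀ i j → M ℕ.≤ i → M ℕ.≤ j → ∣ root-seq i -ℚ root-seq j ∣ ≤ℚ ε
    bound i j Mi Mj with ℚ.∣p∣≡p∨∣p∣≡-p (root-seq i -ℚ root-seq j)
    ... | inj₁ eq = subst (_≤ℚ ε) (sym eq)
      (ℚ.≤-trans (sub-≤ (root-seq-≤ i j)) (f j Mj))
    ... | inj₂ eq = subst (_≤ℚ ε)
      (sym (trans eq (solve 2 (λ a b → :- (a :- b) := b :- a) refl (root-seq i) (root-seq j))))
      (ℚ.≤-trans (sub-≤ (root-seq-≤ j i)) (f i Mi))

root : ∀ m .{{_ : NonZero m}} → ℕ → ℝ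
root m k = mkℝ (root-seq m k) (root-cauchy m k)

infix 9 _^1/_

-- root-≥0 and root-^ below show that this is the nonnegative m-th root of k.
_^1/_ : ℕ → ∀ m .{{_ : NonZero m}} → ℝ
k ^1/ m = root m k

pow : ℚ → ℕ → ℚ
pow q zero    = 1ℚ
pow q (suc n) = q *ℚ pow q n

seq-^ : ∀ x n i → seq (x ^ n) i ≡ pow (seq x i) n
seq-^ x zero    i = refl
seq-^ x (suc n) i = cong (seq x i *ℚ_) (seq-^ x n i)

near-pow : ∀ x y → Near x y → ∀ n → Near (λ i → pow (x i) n) (λ i → pow (y i) n)
near-pow x y p zero    = near-const 1ℚ
near-pow x y p (suc n) =
  near-* x y (λ i → pow (x i) n) (λ i → pow (y i) n) p (near-pow x y p n)

frac-* : ∀ a d b → (+ a ℚ./ suc d) *ℚ (+ b ℚ./ 1) ≡ + (a ℕ.* b) ℚ./ suc d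
frac-* a d b = ℚ.toℚᵘ-injective
  (ℚᵘ.≃-trans (ℚ.toℚᵘ-homo-* (+ a ℚ./ suc d) (+ b ℚ./ 1))
  (ℚᵘ.≃-trans (ℚᵘ.*-cong (ℚ.toℚᵘ-fromℚᵘ (ℚᵘ.mkℚᵘ (+ a) d)) (ℚ.toℚᵘ-fromℚᵘ (ℚᵘ.mkℚᵘ (+ b) 0)))
  (ℚᵘ.≃-trans (ℚᵘ.*≡* (cong₂ ℤ._*_ (sym (ℤ.pos-* a b)) (cong +_ (sym (ℕ.*-identityʳ (suc d))))))
              (ℚᵘ.≃-sym (ℚ.toℚᵘ-fromℚᵘ (ℚᵘ.mkℚᵘ (+ (a ℕ.* b)) d))))))

frac-cancel : ∀ a d → + (a ℕ.* suc d) ℚ./ suc d ≡ + a ℚ./ 1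
frac-cancel a d = ℚ.≤-antisym
  (frac-≤ (a ℕ.* suc d) d a 0 (ℕ.≤-reflexive (ℕ.*-identityʳ _)))
  (frac-≤ a 0 (a ℕ.* suc d) d (ℕ.≤-reflexive (sym (ℕ.*-identityʳ _))))

pow-frac : ∀ a d n → pow (+ a ℚ./ suc d) n *ℚ (+ (suc d ℕ.^ n) ℚ./ 1) ≡ + (a ℕ.^ n) ℚ./ 1
pow-frac a d zero    = refl
pow-frac a d (suc n) = begin
  q *ℚ pow q n *ℚ ι (suc d ℕ.* suc d ℕ.^ n)
    ≡⟨ cong (q *ℚ pow q n *ℚ_) (frac-* (suc d) 0 (suc d ℕ.^ n)) ⟨
  q *ℚ pow q n *ℚ (ι (suc d) *ℚ ι (suc d ℕ.^ n))
    ≡⟨ solve 4 (λ a b c e → a :* b :* (c :* e) := a :* c :* (b :* e)) refl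
         q (pow q n) (ι (suc d)) (ι (suc d ℕ.^ n)) ⟩
  q *ℚ ι (suc d) *ℚ (pow q n *ℚ ι (suc d ℕ.^ n))
    ≡⟨ cong₂ _*ℚ_ (trans (frac-* a d (suc d)) (frac-cancel a d)) (pow-frac a d n) ⟩
  ι a *ℚ ι (a ℕ.^ n)
    ≡⟨ frac-* a 0 (a ℕ.^ n) ⟩
  ι (a ℕ.* a ℕ.^ n) ∎
  where
  open ≡-Reasoning
  open +-*-Solver
  ι : ℕ → ℚ
  ι n = + n ℚ./ 1
  q = + a ℚ./ suc d

module _ (m : ℕ) .{{_ : NonZero m}} (k : ℕ) where

  private
    ι : ℕ → ℚ
    ι n = + n ℚ./ 1

    ι-≤ : ∀ {a b} → a ℕ.≤ b → ι a ≤ℚ ι b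
    ι-≤ {a} {b} h = frac-≤ a 0 b 0 (ℕ.*-monoˡ-≤ 1 h)

    scale : ∀ n → ℚ.Positive (ι (suc n ℕ.^ m))
    scale n = ℚ.positive (ℚ.<-≤-trans (ℚ.positive⁻¹ 1ℚ) (ι-≤ (ℕ.m^n>0 (suc n) m)))

    pow-root-≤ : ∀ n → pow (root-seq m k n) m ≤ℚ ι k
    pow-root-≤ n = ℚ.*-cancelʳ-≤-pos (ι (suc n ℕ.^ m)) {{scale n}}
      (subst₂ _≤ℚ_ (sym (pow-frac (root-num m k n) n m)) (sym (frac-* k 0 (suc n ℕ.^ m)))
        (ι-≤ (root-num-≤ m k n)))

    ≤-pow-root : ∀ n → ι k ≤ℚ pow (root-seq m k n +ℚ 1/suc n) m
    ≤-pow-root n = subst (λ q → ι k ≤ℚ pow q m) (frac-suc (root-num m k n) n)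
      (ℚ.*-cancelʳ-≤-pos (ι (suc n ℕ.^ m)) {{scale n}}
        (subst₂ _≤ℚ_ (sym (frac-* k 0 (suc n ℕ.^ m))) (sym (pow-frac (suc (root-num m k n)) n m))
          (ι-≤ (ℕ.<⇒≤ (root-num-< m k n)))))

    near-zero : Near 1/suc (λ _ → 0ℚ)
    near-zero ε 0<ε with archimedean ε 0<ε
    ... | M , f = M , λ i j Mi Mj → subst (_≤ℚ ε)
      (sym (trans (cong ∣_∣ (ℚ.+-identityʳ (1/suc i)))
                  (ℚ.0≤p⇒∣p∣≡p (frac-≤ 0 0 1 i ℕ.z≤n))))
      (f i Mi)

    near-upper : Near (λ n → root-seq m k n +ℚ 1/suc n) (λ n → root-seq m k n +ℚ 0ℚ)
    near-upper = near-+ (root-seq m k) (root-seq m k) 1/suc (λ _ → 0ℚ) (root-cauchy m k) near-zero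

    ≤-from-∣-∣ : ∀ {a b c} → ∣ a -ℚ b ∣ ≤ℚ c → a ≤ℚ b +ℚ c
    ≤-from-∣-∣ {a} {b} {c} h = begin
      a                 ≡⟨ solve 2 (λ a b → a := b :+ (a :- b)) refl a b ⟩
      b +ℚ (a -ℚ b)     ≤⟨ ℚ.+-monoʳ-≤ b (p≤∣p∣ (a -ℚ b)) ⟩
      b +ℚ ∣ a -ℚ b ∣   ≤⟨ ℚ.+-monoʳ-≤ b h ⟩
      b +ℚ c            ∎
      where
      open ℚ.≤-Reasoning
      open +-*-Solver
      p≤∣p∣ : ∀ p → p ≤ℚ ∣ p ∣
      p≤∣p∣ p with ℚ.≤-total 0ℚ p
      ... | inj₁ 0≤p = ℚ.≤-reflexive (sym (ℚ.0≤p⇒∣p∣≡p 0≤p))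
      ... | inj₂ p≤0 = ℚ.≤-trans p≤0 (ℚ.0≤∣p∣ p)

  root-≥0 : root m k ≥ fromℕ 0
  root-≥0 ε 0<ε = 0 , λ n _ →
    ℚ.+-mono-≤ {0ℚ} {root-seq m k n} {0ℚ} {ε} (frac-≤ 0 0 (root-num m k n) n ℕ.z≤n) (ℚ.<⇒≤ 0<ε)

  root-^ : root m k ^ m ≃ fromℕ k
  root-^ = upper , lower
    where
    open ℚ.≤-Reasoning
    upper : root m k ^ m ≤ fromℕ k
    upper ε 0<ε = 0 , λ n _ → begin
      seq (root m k ^ m) n     ≡⟨ seq-^ (root m k) m n ⟩
      pow (root-seq m k n) m   ≤⟨ pow-root-≤ n ⟩
      ι k                      ≡⟨ ℚ.+-identityʳ (ι k) ⟨
      ι k +ℚ 0ℚ                ≤⟨ ℚ.+-monoʳ-≤ (ι k) (ℚ.<⇒≤ 0<ε) ⟩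
      ι k +ℚ ε                 ∎
    lower : fromℕ k ≤ root m k ^ m
    lower ε 0<ε =
      let M , f = near-pow (λ n → root-seq m k n +ℚ 1/suc n) (λ n → root-seq m k n +ℚ 0ℚ)
                    near-upper m ε 0<ε
      in M , λ n Mn → begin
      ι k                                       ≤⟨ ≤-pow-root n ⟩
      pow (root-seq m k n +ℚ 1/suc n) m         ≤⟨ ≤-from-∣-∣ (f n n Mn Mn) ⟩
      pow (root-seq m k n +ℚ 0ℚ) m +ℚ ε         ≡⟨ cong (λ q → pow q m +ℚ ε) (ℚ.+-identityʳ (root-seq m k n)) ⟩
      pow (root-seq m k n) m +ℚ ε               ≡⟨ cong (_+ℚ ε) (seq-^ (root m k) m n) ⟨
      seq (root m k ^ m) n +ℚ ε                 ∎

-- The index i stands for the integer value i = i + 1, so Fin N is {1, …, N}.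
value : ∀ {N} → Fin N → ℕ
value i = suc (toℕ i)

Coloring : ℕ → ℕ → Set
Coloring N r = Fin N → Fin r

IsSolution : ∀ {N m} → (Fin (suc m) → Fin N) → (Fin m → Fin N) → Set
IsSolution x y = sum (λ i → value (x i)) ≡ sum (λ j → value (y j))

IsMonochromatic : ∀ {N r m} → Coloring N r → (Fin (suc m) → Fin N) → (Fin m → Fin N) → Set
IsMonochromatic φ x y = ∃ λ c → (∀ i → φ (x i) ≡ c) × (∀ j → φ (y j) ≡ c)

HasMonochromaticSolution : ∀ {N r} → ℕ → Coloring N r → Set
HasMonochromaticSolution m φ =
  ∃₂ λ x y → IsSolution {m = m} x y × IsMonochromatic φ x y

-- Colour the edge between two of the integers 0, …, N by the colour of their difference, and
-- suppose that there is no monochromatic solution. Then in any colour the vertices reached from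
-- a common vertex by walks with the same steps, at most m in number and each forward or backward,
-- span no edge of that colour.
--
-- Take a set of vertices, each with a set of live colours containing the colours of all its edges
-- within the set, and give a vertex with l live colours the weight ∏_{l < j ≤ r} (1 + 2 j^{1/m}).
-- The total weight W never exceeds Ω = ∏_{j ≤ r} (1 + 2 j^{1/m}), by induction on the number of
-- pairs of a vertex and a live colour; if all colours are live at 0, …, N, then W = N + 1.
-- Suppose W > Ω, take a vertex v with the fewest live colours, say k, and let c be one of them.
-- Start from the forward (or backward) c-neighbours S of v and repeatedly pass to the forward or
-- the backward c-neighbours, whichever weigh more. Each step multiplies the weight by at least
-- k^{1/m}: otherwise deleting all c-neighbours of the current set and killing c on it does not
-- lower W, against the induction hypothesis. After m − 1 steps the induction hypothesis for the
-- current set alone, with c killed, gives k^{(m−1)/m} (1 + 2 k^{1/m}) weight(S) ≤ Ω. Summing over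
-- the k colours and both directions, W − weight(v) ≤ 2 k^{1/m} Ω / (1 + 2 k^{1/m}), while
-- weight(v) ≤ Ω / (1 + 2 k^{1/m}).
--
-- To stay in ℕ, j^{1/m} is replaced by b j / d > j^{1/m} with a large common denominator d, and
-- all weights are multiplied by d^r.
module Submission where

open import Data.Nat.Base as ℕ using (ℕ; zero; suc; NonZero)

module ColourWeights where

  open import Data.Bool.Base using (if_then_else_)
  open import Data.Nat.Base using (ℕ; zero; suc; NonZero; _+_; _*_; _^_; _≤_; _<_; z≤n; s≤s;
    >-nonZero; >-nonZero⁻¹)
  open import Data.Nat.Properties
  open import Data.Nat.Tactic.RingSolver using (solve-∀)
  open import Data.Fin.Base using (Fin; zero; suc)
  import Data.Fin.Properties as Fin
  open import Data.Fin.Properties using (any?)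
  open import Data.Fin.Subset using (Subset; _∈_; inside; outside; _-_; ∣_∣)
  open import Data.Fin.Subset.Properties using (_∈?_; ∣p∣≤n; x∈p∧x≢y⇒x∈p-y; x∈p⇒∣p-x∣<∣p∣)
  open import Data.Vec.Base using ([]; _∷_)
  open import Data.Product using (∃; _×_; _,_; proj₁; proj₂)
  open import Data.Sum.Base using (_⊎_; inj₁; inj₂)
  open import Data.Empty using (⊥)
  open import Relation.Nullary using (Dec; does; yes; no; ¬_; contradiction)
  open import Relation.Nullary.Decidable using (_×-dec_; ¬?; dec-true; dec-false)
  open import Relation.Unary using (Decidable)
  open import Relation.Binary.PropositionalEquality
    using (_≡_; _≢_; refl; sym; trans; cong; cong₂)
  open import Algebra.Properties.Monoid.Sum +-0-monoid using (sum; sum-cong-≗; sum-replicate-zero)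
  open import Algebra.Properties.CommutativeMonoid.Sum +-0-commutativeMonoid using (∑-distrib-+; ∑-comm)
  open import Algebra.Properties.Semiring.Sum +-*-semiring using (*-distribˡ-sum)

  -- Finite sums, indicators and minima.

  sum-mono-≤ : ∀ {n} {f g : Fin n → ℕ} → (∀ i → f i ≤ g i) → sum f ≤ sum g
  sum-mono-≤ {zero}  h = z≤n
  sum-mono-≤ {suc n} h = +-mono-≤ (h zero) (sum-mono-≤ (λ i → h (suc i)))

  sum-mono-< : ∀ {n} {f g : Fin n → ℕ} → (∀ i → f i ≤ g i) → ∀ j → f j < g j → sum f < sum g
  sum-mono-< h zero    lt = +-mono-<-≤ lt (sum-mono-≤ (λ i → h (suc i)))
  sum-mono-< h (suc j) lt = +-mono-≤-< (h zero) (sum-mono-< (λ i → h (suc i)) j lt)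

  sum-zero : ∀ {n} {f : Fin n → ℕ} → (∀ i → f i ≡ 0) → sum f ≡ 0
  sum-zero {n} h = trans (sum-cong-≗ h) (sum-replicate-zero n)

  ≤-sum : ∀ {n} (f : Fin n → ℕ) i → f i ≤ sum f
  ≤-sum f zero    = m≤m+n _ _
  ≤-sum f (suc i) = ≤-trans (≤-sum (λ j → f (suc j)) i) (m≤n+m _ _)

  infixr 8 [_]_

  -- Only `does` is inspected, so the indicator computes on deciders such as `suc x ≟ suc v`;
  -- `sum-≟` and `sum-∈?` rely on this.
  [_]_ : ∀ {A : Set} → Dec A → ℕ → ℕ
  [ a? ] x = if does a? then x else 0

  []-yes : ∀ {A : Set} (a? : Dec A) {x} → A → [ a? ] x ≡ x
  []-yes a? {x} a = cong (if_then x else 0) (dec-true a? a)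

  []-no : ∀ {A : Set} (a? : Dec A) {x} → ¬ A → [ a? ] x ≡ 0
  []-no a? {x} ¬a = cong (if_then x else 0) (dec-false a? ¬a)

  []-≤ : ∀ {A : Set} (a? : Dec A) x → [ a? ] x ≤ x
  []-≤ (yes _) x = ≤-refl
  []-≤ (no  _) x = z≤n

  []-mono : ∀ {A B : Set} (a? : Dec A) (b? : Dec B) {x y} → (A → B × x ≤ y) → [ a? ] x ≤ [ b? ] y
  []-mono (no _)  b? h = z≤n
  []-mono (yes a) b? h = ≤-trans (proj₂ (h a)) (≤-reflexive (sym ([]-yes b? (proj₁ (h a)))))

  *-[]-≤ : ∀ {A : Set} (a? : Dec A) k {x y} → (A → k * x ≤ y) → k * [ a? ] x ≤ [ a? ] y
  *-[]-≤ (yes a) k h = h a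
  *-[]-≤ (no _)  k h = ≤-reflexive (*-zeroʳ k)

  sum-≟ : ∀ {n} (f : Fin n → ℕ) v → sum (λ x → [ x Fin.≟ v ] f x) ≡ f v
  sum-≟ f zero    = trans
    (cong (f zero +_) (sum-zero {f = λ x → [ suc x Fin.≟ zero ] f (suc x)} (λ _ → refl)))
    (+-identityʳ _)
  sum-≟ f (suc v) = sum-≟ (λ x → f (suc x)) v

  sum-∈? : ∀ {n} (p : Subset n) x → sum (λ c → [ c ∈? p ] x) ≡ ∣ p ∣ * x
  sum-∈? []            x = refl
  sum-∈? (inside  ∷ p) x = cong (x +_) (sum-∈? p x)
  sum-∈? (outside ∷ p) x = sum-∈? p x

  argmin : ∀ {n} {P : Fin n → Set} (P? : Decidable P) (f : Fin n → ℕ) → ∃ P →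
           ∃ λ v → P v × (∀ {x} → P x → f v ≤ f x)
  argmin {P = P} P? f (v₀ , p₀) = go (f v₀) v₀ p₀ ≤-refl
    where
    -- `k` bounds the current value and falls by one whenever a smaller value is found.
    go : ∀ k v → P v → f v ≤ k → ∃ λ v → P v × (∀ {x} → P x → f v ≤ f x)
    go k v pv le with any? (λ u → P? u ×-dec f u <? f v)
    ... | no ∄ = v , pv , λ {x} px → ≮⇒≥ λ lt → ∄ (x , px , lt)
    go zero    v pv le | yes (u , pu , lt) = contradiction (≤-trans lt le) λ ()
    go (suc k) v pv le | yes (u , pu , lt) = go k u pu (≤-pred (≤-trans lt le))

  d*[z+z]≡2*[d*z] : ∀ d z → d * (z + z) ≡ 2 * (d * z)
  d*[z+z]≡2*[d*z] = solve-∀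

  -- Used to pass to the heavier of the forward and backward neighbourhoods; the equation on `z`
  -- records which one was taken.
  larger-summand : ∀ {x} d a b → x < d * (a + b) → ∃ λ z → (z ≡ a ⊎ z ≡ b) × x ≤ 2 * (d * z)
  larger-summand d a b lt with ≤-total a b
  ... | inj₁ a≤b = b , inj₂ refl , ≤-trans (<⇒≤ lt)
    (≤-trans (*-monoʳ-≤ d (+-monoˡ-≤ b a≤b)) (≤-reflexive (d*[z+z]≡2*[d*z] d b)))
  ... | inj₂ b≤a = a , inj₁ refl , ≤-trans (<⇒≤ lt)
    (≤-trans (*-monoʳ-≤ d (+-monoʳ-≤ a b≤a)) (≤-reflexive (d*[z+z]≡2*[d*z] d a)))

  -- The weight bound for an edge-coloured graph.

  module Weights
    {n r m-1 : ℕ}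
    (E : Fin r → Fin n → Fin n → Set)
    (E? : ∀ c x y → Dec (E c x y))
    (E-total : ∀ {x y} → x ≢ y → ∃ λ c → E c x y ⊎ E c y x)
    (Twin : ℕ → Fin r → Fin n → Fin n → Set)
    (twin-refl : ∀ {c v} → Twin 0 c v v)
    (twin-out : ∀ {i c u v x y} → Twin i c u v → E c u x → E c v y → Twin (suc i) c x y)
    (twin-in  : ∀ {i c u v x y} → Twin i c u v → E c x u → E c y v → Twin (suc i) c x y)
    (twin-indep : ∀ {i c u v} → i ≤ suc m-1 → Twin i c u v → ¬ E c u v)
    (d : ℕ) (b w : ℕ → ℕ) .{{_ : NonZero d}}
    (b-nonZero : ∀ k → NonZero (b k))
    (b-mono : ∀ {j k} → j ≤ k → b j ≤ b k)
    -- So `b k / d` is at least k^{1/m}. By `w-step`, `w l` is `w r` times ∏_{l < j ≤ r} (1 + 2 b_j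
    -- / d).
    (b-pow : ∀ k → k * d ^ suc m-1 ≤ b k ^ suc m-1)
    (w-step : ∀ {l} → l < r → d * w l ≡ (d + 2 * b (suc l)) * w (suc l))
    where

    private m = suc m-1

    w-anti : ∀ {i j} → i ≤ j → j ≤ r → w j ≤ w i
    w-anti {i} {zero}  z≤n _ = ≤-refl
    w-anti {i} {suc j} i≤j j<r with m≤n⇒m<n∨m≡n i≤j
    ... | inj₂ refl = ≤-refl
    ... | inj₁ (s≤s i≤j′) = ≤-trans (*-cancelˡ-≤ d (begin
        d * w (suc j)                        ≤⟨ *-monoˡ-≤ (w (suc j)) (m≤m+n d _) ⟩
        (d + 2 * b (suc j)) * w (suc j)      ≡⟨ w-step j<r ⟨
        d * w j                              ∎)) (w-anti i≤j′ (<⇒≤ j<r))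
      where open ≤-Reasoning

    Live : Set
    Live = Fin n → Subset r

    term : {P : Fin n → Set} → Decidable P → Live → Fin n → ℕ
    term P? L x = [ P? x ] w ∣ L x ∣

    weight : {P : Fin n → Set} → Decidable P → Live → ℕ
    weight P? L = sum (term P? L)

    measure : {P : Fin n → Set} → Decidable P → Live → ℕ
    measure P? L = sum (λ x → [ P? x ] ∣ L x ∣)

    Valid : (Fin n → Set) → Live → Set
    Valid X L = ∀ {c x y} → X x → X y → E c x y → c ∈ L x × c ∈ L y

    module Step
      {X : Fin n → Set} (X? : Decidable X) (L : Live) (valid : Valid X L)
      (ih : ∀ {X′ : Fin n → Set} (X′? : Decidable X′) L′ → Valid X′ L′ →
            measure X′? L′ < measure X? L → weight X′? L′ ≤ w 0)
      (over : w 0 < weight X? L)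
      (v : Fin n) (Xv : X v) (v-min : ∀ {x} → X x → ∣ L v ∣ ≤ ∣ L x ∣)
      where

      private
        k = ∣ L v ∣
        β = b k

      -- Growing sets of neighbours in one colour.

      module Colour (c : Fin r) where

        Out In : (Fin n → Set) → Fin n → Set
        Out S x = X x × ∃ λ u → S u × E c u x
        In  S x = X x × ∃ λ u → S u × E c x u

        out? : ∀ {S} → Decidable S → Decidable (Out S)
        out? S? x = X? x ×-dec any? (λ u → S? u ×-dec E? c u x)

        in? : ∀ {S} → Decidable S → Decidable (In S)
        in? S? x = X? x ×-dec any? (λ u → S? u ×-dec E? c x u)

        -- The invariant preserved by `Out` and `In`. Through `twins`, a set at stage i ≤ m spans no
        -- edge of colour `c`.
        record Stage (i : ℕ) (S : Fin n → Set) : Set where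
          field
            within : ∀ {x} → S x → X x
            live   : ∀ {x} → S x → c ∈ L x
            twins  : ∀ {x y} → S x → S y → Twin i c x y

        open Stage

        stage-out : ∀ {i S} → Stage i S → Stage (suc i) (Out S)
        stage-out st .within = proj₁
        stage-out st .live  (Xx , u , Su , e) = proj₂ (valid (st .within Su) Xx e)
        stage-out st .twins (_ , u , Su , e) (_ , u′ , Su′ , e′) = twin-out (st .twins Su Su′) e e′

        stage-in : ∀ {i S} → Stage i S → Stage (suc i) (In S)
        stage-in st .within = proj₁
        stage-in st .live  (Xx , u , Su , e) = proj₁ (valid Xx (st .within Su) e)
        stage-in st .twins (_ , u , Su , e) (_ , u′ , Su′ , e′) = twin-in (st .twins Su Su′) e e′

        kill : ∀ {S : Fin n → Set} → Decidable S → Live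
        kill S? x = if does (S? x) then L x - c else L x

        kill-yes : ∀ {S : Fin n → Set} (S? : Decidable S) {x} → S x → kill S? x ≡ L x - c
        kill-yes S? {x} s = cong (if_then L x - c else L x) (dec-true (S? x) s)

        kill-no : ∀ {S : Fin n → Set} (S? : Decidable S) {x} → ¬ S x → kill S? x ≡ L x
        kill-no S? {x} s = cong (if_then L x - c else L x) (dec-false (S? x) s)

        ∈-kill : ∀ {S : Fin n → Set} (S? : Decidable S) {x e} → e ∈ L x → (S x → e ≢ c) → e ∈ kill S? x
        ∈-kill S? {x} e∈ e≢c with S? x
        ... | yes s = x∈p∧x≢y⇒x∈p-y e∈ (e≢c s)
        ... | no  _ = e∈

        -- The strict drop occurs at the given point of `S`, where `c` was live: that point either
        -- leaves the set or loses `c`.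
        measure-kill : ∀ {i S Y} (S? : Decidable S) (Y? : Decidable Y) → Stage i S →
                       (∀ {x} → Y x → X x) → ∃ S → measure Y? (kill S?) < measure X? L
        measure-kill S? Y? st Y⊆X (s , Ss) = sum-mono-< le s (begin-strict
            [ Y? s ] ∣ kill S? s ∣   ≤⟨ []-≤ (Y? s) _ ⟩
            ∣ kill S? s ∣            ≡⟨ cong ∣_∣ (kill-yes S? Ss) ⟩
            ∣ L s - c ∣              <⟨ x∈p⇒∣p-x∣<∣p∣ (st .live Ss) ⟩
            ∣ L s ∣                  ≡⟨ []-yes (X? s) (st .within Ss) ⟨
            [ X? s ] ∣ L s ∣         ∎)
          where
          open ≤-Reasoning
          le : ∀ x → [ Y? x ] ∣ kill S? x ∣ ≤ [ X? x ] ∣ L x ∣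
          le x = []-mono (Y? x) (X? x) λ Yx → Y⊆X Yx , kill-≤
            where
            kill-≤ : ∣ kill S? x ∣ ≤ ∣ L x ∣
            kill-≤ with S? x
            ... | yes s = <⇒≤ (x∈p⇒∣p-x∣<∣p∣ (st .live s))
            ... | no  _ = ≤-refl

        -- By `v-min` a vertex of `X` has l ≥ k live colours, and losing one multiplies its weight
        -- by at least 1 + 2 b_l / d ≥ 1 + 2β / d. The choice of `v` is what makes this factor
        -- uniform over `X`.
        gain : ∀ {x} → X x → c ∈ L x → (d + 2 * β) * w ∣ L x ∣ ≤ d * w ∣ L x - c ∣
        gain {x} Xx c∈ = go ∣ L x ∣ (v-min Xx) (∣p∣≤n (L x)) (x∈p⇒∣p-x∣<∣p∣ c∈)
          where
          open ≤-Reasoning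
          go : ∀ l → k ≤ l → l ≤ r → ∣ L x - c ∣ < l → (d + 2 * β) * w l ≤ d * w ∣ L x - c ∣
          go (suc l) k≤ l<r (s≤s lt) = begin
            (d + 2 * β) * w (suc l)          ≤⟨ *-monoˡ-≤ (w (suc l)) (+-monoʳ-≤ d (*-monoʳ-≤ 2 (b-mono k≤))) ⟩
            (d + 2 * b (suc l)) * w (suc l)  ≡⟨ w-step l<r ⟨
            d * w l                          ≤⟨ *-monoʳ-≤ d (w-anti lt (<⇒≤ l<r)) ⟩
            d * w ∣ L x - c ∣                ∎

        indep : ∀ {i S x y} → i ≤ m → Stage i S → S x → S y → ¬ E c x y
        indep i≤m st Sx Sy = twin-indep i≤m (st .twins Sx Sy)

        -- Otherwise delete `Out S` and `In S` from `X` and kill `c` on `S`. The weight gained on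
        -- `S` makes up for the deleted weight, so the smaller configuration still weighs more than
        -- `w 0`, against `ih`.
        no-shrink : ∀ {i S} (S? : Decidable S) → i ≤ m → Stage i S → ∃ S →
          2 * β * weight S? L < d * (weight (out? S?) L + weight (in? S?) L)
        no-shrink {i} {S} S? i≤m st ∃S = ≰⇒> λ small → <⇒≱ over (≤-trans
            (*-cancelˡ-≤ d (+-cancelʳ-≤ (2 * β * weight S? L) _ _ (begin
              d * weight X? L + 2 * β * weight S? L
                ≡⟨ cong₂ _+_ (*-distribˡ-sum d wX) (*-distribˡ-sum (2 * β) wS) ⟩
              sum (λ x → d * wX x) + sum (λ x → 2 * β * wS x)
                ≡⟨ ∑-distrib-+ (λ x → d * wX x) (λ x → 2 * β * wS x) ⟨
              sum (λ x → d * wX x + 2 * β * wS x)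
                ≤⟨ sum-mono-≤ pointwise ⟩
              sum (λ x → d * wY x + d * (wO x + wI x))
                ≡⟨ ∑-distrib-+ (λ x → d * wY x) (λ x → d * (wO x + wI x)) ⟩
              sum (λ x → d * wY x) + sum (λ x → d * (wO x + wI x))
                ≡⟨ cong₂ _+_ (*-distribˡ-sum d wY) (*-distribˡ-sum d (λ x → wO x + wI x)) ⟨
              d * sum wY + d * sum (λ x → wO x + wI x)
                ≡⟨ cong (λ t → d * sum wY + d * t) (∑-distrib-+ wO wI) ⟩
              d * weight Y? L′ + d * (weight (out? S?) L + weight (in? S?) L)
                ≤⟨ +-monoʳ-≤ (d * weight Y? L′) small ⟩
              d * weight Y? L′ + 2 * β * weight S? L ∎)))
            (ih Y? L′ valid′ (measure-kill S? Y? st proj₁ ∃S)))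
          where
          open ≤-Reasoning
          Y : Fin n → Set
          Y x = X x × ¬ Out S x × ¬ In S x
          Y? : Decidable Y
          Y? x = X? x ×-dec (¬? (out? S? x) ×-dec ¬? (in? S? x))
          L′ = kill S?
          wX wS wY wO wI : Fin n → ℕ
          wX = term X? L
          wS = term S? L
          wY = term Y? L′
          wO = term (out? S?) L
          wI = term (in? S?) L
          -- An edge of colour `c` leaving or entering `S` would put its other end into `Out S` or
          -- `In S`, which `Y` excludes.
          valid′ : Valid Y L′
          valid′ (Xx , _ , x∉I) (Xy , y∉O , _) e with valid Xx Xy e
          ... | ∈x , ∈y = ∈-kill S? ∈x (λ { Sx refl → y∉O (Xy , _ , Sx , e) })
                        , ∈-kill S? ∈y (λ { Sy refl → x∉I (Xx , _ , Sy , e) })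
          -- On `S`, `gain` pays for the extra 2β, and `S` lies in `Y` because it spans no edge of
          -- colour `c`. Off `S`, a vertex of `X` is counted in `wO` or `wI`, or survives in `Y`
          -- with the same live colours.
          pointwise : ∀ x → d * wX x + 2 * β * wS x ≤ d * wY x + d * (wO x + wI x)
          pointwise x = by-cases (S? x) (out? S? x) (in? S? x) (X? x)
            where
            W = w ∣ L x ∣
            outside-S : ¬ S x → d * W ≤ d * wY x + d * (wO x + wI x) →
                        d * wX x + 2 * β * wS x ≤ d * wY x + d * (wO x + wI x)
            outside-S ¬s h = ≤-trans (+-mono-≤ (*-monoʳ-≤ d ([]-≤ (X? x) W))
              (≤-reflexive (trans (cong (2 * β *_) ([]-no (S? x) ¬s)) (*-zeroʳ (2 * β)))))
              (≤-trans (≤-reflexive (+-identityʳ _)) h)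
            by-cases : Dec (S x) → Dec (Out S x) → Dec (In S x) → Dec (X x) →
                       d * wX x + 2 * β * wS x ≤ d * wY x + d * (wO x + wI x)
            by-cases (yes s) _ _ _ = begin
              d * wX x + 2 * β * wS x   ≤⟨ +-mono-≤ (*-monoʳ-≤ d ([]-≤ (X? x) W)) (*-monoʳ-≤ (2 * β) ([]-≤ (S? x) W)) ⟩
              d * W + 2 * β * W         ≡⟨ *-distribʳ-+ W d (2 * β) ⟨
              (d + 2 * β) * W           ≤⟨ gain (st .within s) (st .live s) ⟩
              d * w ∣ L x - c ∣         ≡⟨ cong (λ p → d * w ∣ p ∣) (kill-yes S? s) ⟨
              d * w ∣ L′ x ∣            ≡⟨ cong (d *_) ([]-yes (Y? x)
                  (st .within s , (λ { (_ , _ , Su , e) → indep i≤m st Su s e })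
                                , (λ { (_ , _ , Su , e) → indep i≤m st s Su e }))) ⟨
              d * wY x                  ≤⟨ m≤m+n _ _ ⟩
              d * wY x + d * (wO x + wI x) ∎
            by-cases (no ¬s) (yes o) _ _ = outside-S ¬s (≤-trans
              (*-monoʳ-≤ d (≤-trans (≤-reflexive (sym ([]-yes (out? S? x) o))) (m≤m+n _ _))) (m≤n+m _ _))
            by-cases (no ¬s) (no _) (yes i) _ = outside-S ¬s (≤-trans
              (*-monoʳ-≤ d (≤-trans (≤-reflexive (sym ([]-yes (in? S? x) i))) (m≤n+m _ (wO x)))) (m≤n+m _ _))
            by-cases (no ¬s) (no ¬o) (no ¬i) (yes Xx) = outside-S ¬s (≤-trans (≤-reflexive
              (cong (d *_) (trans (cong (λ p → w ∣ p ∣) (sym (kill-no S? ¬s)))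
                (sym ([]-yes (Y? x) (Xx , ¬o , ¬i)))))) (m≤m+n _ _))
            by-cases (no ¬s) (no _) (no _) (no ¬Xx) = ≤-trans (≤-reflexive
              (trans (cong₂ (λ p q → d * p + 2 * β * q) ([]-no (X? x) ¬Xx) ([]-no (S? x) ¬s))
                (cong₂ _+_ (*-zeroʳ d) (*-zeroʳ (2 * β))))) z≤n

        weight-empty : ∀ {S : Fin n → Set} (S? : Decidable S) → ¬ ∃ S → weight S? L ≡ 0
        weight-empty S? ∄ = sum-zero (λ x → []-no (S? x) (λ s → ∄ (x , s)))

        -- `S` alone, with `c` killed on all of it, is still valid, since `S` spans no edge of
        -- colour `c`. Apply `ih` to it and `gain` to each vertex.
        last-stage : ∀ {S} (S? : Decidable S) → Stage m S → ∃ S → (d + 2 * β) * weight S? L ≤ d * w 0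
        last-stage S? st ∃S = begin
          (d + 2 * β) * weight S? L                  ≡⟨ *-distribˡ-sum (d + 2 * β) (term S? L) ⟩
          sum (λ x → (d + 2 * β) * term S? L x)  ≤⟨ sum-mono-≤ pointwise ⟩
          sum (λ x → d * term S? (kill S?) x)   ≡⟨ *-distribˡ-sum d (term S? (kill S?)) ⟨
          d * weight S? (kill S?)                    ≤⟨ *-monoʳ-≤ d (ih S? (kill S?) valid′ (measure-kill S? S? st (st .within) ∃S)) ⟩
          d * w 0                                    ∎
          where
          open ≤-Reasoning
          valid′ : Valid _ (kill S?)
          valid′ Sx Sy e with valid (st .within Sx) (st .within Sy) e
          ... | ∈x , ∈y = ∈-kill S? ∈x (λ { _ refl → indep ≤-refl st Sx Sy e })
                        , ∈-kill S? ∈y (λ { _ refl → indep ≤-refl st Sx Sy e })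
          pointwise : ∀ x → (d + 2 * β) * term S? L x ≤ d * term S? (kill S?) x
          pointwise x with S? x
          ... | yes s = gain (st .within s) (st .live s)
          ... | no  _ = ≤-reflexive (trans (*-zeroʳ (d + 2 * β)) (sym (*-zeroʳ d)))

        -- Induction on the number `j` of steps left. Each step passes to a neighbourhood of weight
        -- at least β / d times that of `S`, and `last-stage` closes the chain.
        chain : ∀ j i {S} (S? : Decidable S) → i + j ≡ m → Stage i S →
                β ^ j * ((d + 2 * β) * weight S? L) ≤ d ^ suc j * w 0
        chain j i S? i+j≡m st with any? S?
        -- The empty set is treated apart because killing `c` on it would not lower the measure, so
        -- `ih` could not be applied.
        chain j i S? i+j≡m st | no ∄ = ≤-trans (≤-reflexive
          (trans (cong (λ t → β ^ j * ((d + 2 * β) * t)) (weight-empty S? ∄))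
            (trans (cong (β ^ j *_) (*-zeroʳ (d + 2 * β))) (*-zeroʳ (β ^ j))))) z≤n
        chain zero i S? i≡m st | yes ∃S rewrite +-identityʳ i | i≡m =
          ≤-trans (≤-reflexive (*-identityˡ _))
            (≤-trans (last-stage S? st ∃S) (≤-reflexive (cong (_* w 0) (sym (*-identityʳ d)))))
        chain (suc j) i {S} S? i+j≡m st | yes ∃S =
          grow (larger-summand d _ _ (no-shrink S? (m+n≤o⇒m≤o i (≤-reflexive i+j≡m)) st ∃S))
          where
          open ≤-Reasoning
          i+j≡m′ : suc i + j ≡ m
          i+j≡m′ = trans (sym (+-suc i j)) i+j≡m
          swap : ∀ β γ x t → β * x * (γ * t) ≡ x * (γ * (β * t))
          swap = solve-∀
          swap′ : ∀ d γ x t → x * (γ * (d * t)) ≡ d * (x * (γ * t))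
          swap′ = solve-∀
          finish : ∀ t → 2 * β * weight S? L ≤ 2 * (d * t) →
                   β ^ j * ((d + 2 * β) * t) ≤ d ^ suc j * w 0 →
                   β ^ suc j * ((d + 2 * β) * weight S? L) ≤ d ^ suc (suc j) * w 0
          finish t h h′ = begin
            β * β ^ j * ((d + 2 * β) * weight S? L)      ≡⟨ swap β (d + 2 * β) (β ^ j) (weight S? L) ⟩
            β ^ j * ((d + 2 * β) * (β * weight S? L))
              ≤⟨ *-monoʳ-≤ (β ^ j) (*-monoʳ-≤ (d + 2 * β) (*-cancelˡ-≤ 2
                   (≤-trans (≤-reflexive (sym (*-assoc 2 β (weight S? L)))) h))) ⟩
            β ^ j * ((d + 2 * β) * (d * t))              ≡⟨ swap′ d (d + 2 * β) (β ^ j) t ⟩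
            d * (β ^ j * ((d + 2 * β) * t))              ≤⟨ *-monoʳ-≤ d h′ ⟩
            d * (d ^ suc j * w 0)                        ≡⟨ *-assoc d (d ^ suc j) (w 0) ⟨
            d ^ suc (suc j) * w 0                        ∎
          grow : (∃ λ z → (z ≡ weight (out? S?) L ⊎ z ≡ weight (in? S?) L) ×
                          2 * β * weight S? L ≤ 2 * (d * z)) →
                 β ^ suc j * ((d + 2 * β) * weight S? L) ≤ d ^ suc (suc j) * w 0
          grow (_ , inj₁ refl , h) = finish _ h (chain j (suc i) (out? S?) i+j≡m′ (stage-out st))
          grow (_ , inj₂ refl , h) = finish _ h (chain j (suc i) (in? S?) i+j≡m′ (stage-in st))

        start? : Decidable (_≡ v)
        start? x = x Fin.≟ v

        stage-start : c ∈ L v → Stage 0 (_≡ v)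
        stage-start c∈ .within refl = Xv
        stage-start c∈ .live   refl = c∈
        stage-start c∈ .twins  refl refl = twin-refl

        outW inW : Fin n → ℕ
        outW = term (out? start?) L
        inW  = term (in? start?) L

        neighbours : c ∈ L v →
          β ^ m-1 * (d + 2 * β) * (sum outW + sum inW) ≤ 2 * (d ^ m * w 0)
        neighbours c∈ = begin
          B * (sum outW + sum inW)       ≡⟨ *-distribˡ-+ B (sum outW) (sum inW) ⟩
          B * sum outW + B * sum inW
            ≡⟨ cong₂ _+_ (*-assoc (β ^ m-1) (d + 2 * β) _) (*-assoc (β ^ m-1) (d + 2 * β) _) ⟩
          -- The set {v} is at stage 0, so its neighbourhoods are at stage 1 with m - 1 steps left.
          _                              ≤⟨ +-mono-≤ (chain m-1 1 (out? start?) refl (stage-out (stage-start c∈)))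
                                                     (chain m-1 1 (in? start?) refl (stage-in (stage-start c∈))) ⟩
          d ^ m * w 0 + d ^ m * w 0      ≡⟨ cong (d ^ m * w 0 +_) (+-identityʳ _) ⟨
          2 * (d ^ m * w 0)              ∎
          where
          open ≤-Reasoning
          B = β ^ m-1 * (d + 2 * β)

      -- Summing over the colours live at `v`.

      open Colour using (outW; inW; out?; in?; start?; neighbours)

      nbrW : Fin r → ℕ
      nbrW c = [ c ∈? L v ] (sum (outW c) + sum (inW c))

      T = sum nbrW

      -- By `E-total` every vertex of `X` other than `v` is joined to `v`, and by validity the
      -- colour of the edge is live at `v`. Exchanging the sums groups these vertices by colour.
      cover : weight X? L ≤ w k + T
      cover = begin
        weight X? L
          ≤⟨ sum-mono-≤ pointwise ⟩
        sum (λ x → [ x Fin.≟ v ] w ∣ L x ∣ + sum (λ c → [ c ∈? L v ] (outW c x + inW c x)))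
          ≡⟨ ∑-distrib-+ (λ x → [ x Fin.≟ v ] w ∣ L x ∣) _ ⟩
        sum (λ x → [ x Fin.≟ v ] w ∣ L x ∣) + sum (λ x → sum (λ c → [ c ∈? L v ] (outW c x + inW c x)))
          ≡⟨ cong₂ _+_ (sum-≟ (λ x → w ∣ L x ∣) v) (∑-comm (λ x c → [ c ∈? L v ] (outW c x + inW c x))) ⟩
        w k + sum (λ c → sum (λ x → [ c ∈? L v ] (outW c x + inW c x)))
          ≡⟨ cong (w k +_) (sum-cong-≗ pull) ⟩
        w k + T ∎
        where
        open ≤-Reasoning
        pull : ∀ c → sum (λ x → [ c ∈? L v ] (outW c x + inW c x)) ≡ [ c ∈? L v ] (sum (outW c) + sum (inW c))
        pull c with c ∈? L v
        ... | yes _ = ∑-distrib-+ (outW c) (inW c)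
        ... | no  _ = sum-zero {n} (λ _ → refl)
        pointwise : ∀ x → [ X? x ] w ∣ L x ∣ ≤
          [ x Fin.≟ v ] w ∣ L x ∣ + sum (λ c → [ c ∈? L v ] (outW c x + inW c x))
        pointwise x = by-cases (X? x) (x Fin.≟ v)
          where
          S = sum (λ c → [ c ∈? L v ] (outW c x + inW c x))
          nbr : ∀ c → c ∈ L v → w ∣ L x ∣ ≤ outW c x + inW c x → w ∣ L x ∣ ≤ S
          nbr c c∈ h = ≤-trans h (≤-trans (≤-reflexive (sym ([]-yes (c ∈? L v) c∈)))
            (≤-sum (λ c → [ c ∈? L v ] (outW c x + inW c x)) c))
          edge : X x → (∃ λ c → E c x v ⊎ E c v x) → w ∣ L x ∣ ≤ S
          edge Xx (c , inj₁ e) = nbr c (proj₂ (valid Xx Xv e)) (≤-trans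
            (≤-reflexive (sym ([]-yes (in? c (start? c) x) (Xx , v , refl , e)))) (m≤n+m _ (outW c x)))
          edge Xx (c , inj₂ e) = nbr c (proj₁ (valid Xv Xx e)) (≤-trans
            (≤-reflexive (sym ([]-yes (out? c (start? c) x) (Xx , v , refl , e)))) (m≤m+n _ _))
          by-cases : Dec (X x) → Dec (x ≡ v) → [ X? x ] w ∣ L x ∣ ≤ [ x Fin.≟ v ] w ∣ L x ∣ + S
          by-cases (no ¬Xx) _ = ≤-trans (≤-reflexive ([]-no (X? x) ¬Xx)) z≤n
          by-cases (yes _) (yes x≡v) = ≤-trans ([]-≤ (X? x) _)
            (≤-trans (≤-reflexive (sym ([]-yes (x Fin.≟ v) x≡v))) (m≤m+n _ S))
          by-cases (yes Xx) (no x≢v) = ≤-trans ([]-≤ (X? x) _)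
            (≤-trans (edge Xx (E-total x≢v)) (m≤n+m S _))

      contra : ⊥
      contra = <⇒≱ over (*-cancelˡ-≤ B (begin
        B * weight X? L                       ≤⟨ *-monoʳ-≤ B cover ⟩
        B * (w k + T)                         ≡⟨ *-distribˡ-+ B (w k) T ⟩
        B * w k + B * T                       ≤⟨ +-monoʳ-≤ (B * w k) B*T≤ ⟩
        B * w k + k * (2 * (d ^ m * w 0))     ≤⟨ final k (∣p∣≤n (L v)) refl ⟩
        B * w 0                               ∎))
        where
        open ≤-Reasoning
        B = β ^ m-1 * (d + 2 * β)
        instance
          _ : NonZero β
          _ = b-nonZero k
          _ : NonZero (β ^ m-1)
          _ = m^n≢0 β m-1
          _ : NonZero (d + 2 * β)
          _ = >-nonZero (<-≤-trans (>-nonZero⁻¹ d) (m≤m+n d _))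
          _ : NonZero B
          _ = m*n≢0 (β ^ m-1) (d + 2 * β)
        B*T≤ : B * T ≤ k * (2 * (d ^ m * w 0))
        B*T≤ = begin
          B * T                                                  ≡⟨ *-distribˡ-sum B nbrW ⟩
          sum (λ c → B * nbrW c)
            ≤⟨ sum-mono-≤ (λ c → *-[]-≤ (c ∈? L v) B (neighbours c)) ⟩
          sum (λ c → [ c ∈? L v ] (2 * (d ^ m * w 0)))           ≡⟨ sum-∈? (L v) _ ⟩
          k * (2 * (d ^ m * w 0))                                ∎
        regroup : ∀ k D Ω → k * (2 * (D * Ω)) ≡ 2 * (k * D) * Ω
        regroup = solve-∀
        combine : ∀ β p d Ω → p * (d * Ω) + 2 * (β * p) * Ω ≡ p * (d + 2 * β) * Ω
        combine = solve-∀
        -- A copy `l` of `k` is split, so that β stays `b k`. If k = l + 1, then `w-step` turns the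
        -- first term into β^{m-1} d w_l, at most β^{m-1} d w_0, and `b-pow` gives k d^m ≤ β^m; the
        -- two bounds add up to exactly `B * w 0`.
        final : ∀ l → l ≤ r → k ≡ l → B * w l + l * (2 * (d ^ m * w 0)) ≤ B * w 0
        final zero    _   _  = ≤-reflexive (+-identityʳ _)
        final (suc l) l<r eq = begin
          B * w (suc l) + suc l * (2 * (d ^ m * w 0))
            ≡⟨ cong₂ _+_ (trans (*-assoc (β ^ m-1) (d + 2 * β) (w (suc l)))
                 (cong (β ^ m-1 *_) (trans (cong (λ t → (d + 2 * b t) * w (suc l)) eq) (sym (w-step l<r)))))
                 (regroup (suc l) (d ^ m) (w 0)) ⟩
          β ^ m-1 * (d * w l) + 2 * (suc l * d ^ m) * w 0
            ≤⟨ +-mono-≤ (*-monoʳ-≤ (β ^ m-1) (*-monoʳ-≤ d (w-anti z≤n (<⇒≤ l<r))))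
                        (*-monoˡ-≤ (w 0) (*-monoʳ-≤ 2 (≤-trans (b-pow (suc l))
                           (≤-reflexive (cong (λ t → b t ^ m) (sym eq)))))) ⟩
          β ^ m-1 * (d * w 0) + 2 * (β * β ^ m-1) * w 0
            ≡⟨ combine β (β ^ m-1) d (w 0) ⟩
          B * w 0 ∎

    -- Strong induction on the measure, which `fuel` exceeds; the vertex handed to `Step` has the
    -- fewest live colours.
    weight-≤ : ∀ fuel {X : Fin n → Set} (X? : Decidable X) L → Valid X L →
               measure X? L < fuel → weight X? L ≤ w 0
    weight-≤ (suc fuel) X? L valid (s≤s lt) with any? X?
    ... | no ∄ = ≤-trans (≤-reflexive (sum-zero (λ x → []-no (X? x) (λ Xx → ∄ (x , Xx))))) z≤n
    ... | yes ∃X with argmin X? (λ x → ∣ L x ∣) ∃X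
    ...   | v , Xv , v-min = ≮⇒≥ λ over → Step.contra X? L valid
              (λ X′? L′ valid′ lt′ → weight-≤ fuel X′? L′ valid′ (<-≤-trans lt′ lt)) over v Xv v-min

open ColourWeights using (module Weights)

open import Defs
import Data.Nat.Properties as ℕ
open import Data.Nat.Tactic.RingSolver using (solve-∀)
open import Data.Integer.Base using (+_)
open import Data.Rational.Base as ℚ using (ℚ; 0ℚ; 1ℚ; ½; ∣_∣)
  renaming (_≤_ to _≤ℚ_; _<_ to _<ℚ_; _+_ to _+ℚ_; _-_ to _-ℚ_; _*_ to _*ℚ_)
import Data.Rational.Properties as ℚ
open import Data.Rational.Solver using (module +-*-Solver)
open import Data.Fin.Base using (Fin; zero; suc; toℕ; fromℕ<)
import Data.Fin.Properties as Fin
open import Data.Fin.Properties using (any?; all?)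
import Data.Fin.Subset as Subset
open import Data.Fin.Subset using (⊤)
open import Data.Fin.Subset.Properties using (∈⊤; ∣⊤∣≡n)
open import Data.Product using (∃; ∃₂; _×_; _,_)
open import Data.Sum.Base using (_⊎_; inj₁; inj₂)
open import Data.Unit.Base using (tt) renaming (⊤ to Unit)
open import Data.Vec.Functional using ([]; _∷_)
open import Relation.Nullary using (Dec; yes; no; ¬_; contradiction)
open import Relation.Nullary.Decidable using (map′; _×-dec_; from-yes; decidable-stable)
open import Relation.Unary using (Decidable)
open import Relation.Binary.Definitions using (tri<; tri≈; tri>)
open import Relation.Binary.PropositionalEquality
  using (_≡_; _≢_; _≗_; refl; sym; trans; cong; cong₂; subst; subst₂; module ≡-Reasoning)
open import Algebra.Properties.Monoid.Sum ℕ.+-0-monoid using (sum; sum-cong-≗)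

-- Rational approximations to the real product.

∏ : ℕ → (ℕ → ℕ) → ℕ
∏ zero    f = 1
∏ (suc r) f = ∏ r f ℕ.* f (suc r)

∏ℚ : ℕ → (ℕ → ℚ) → ℚ
∏ℚ zero    f = 1ℚ
∏ℚ (suc r) f = ∏ℚ r f *ℚ f (suc r)

seq-∏ : ∀ r f n → seq (∏₁ r f) n ≡ ∏ℚ r (λ k → seq (f k) n)
seq-∏ zero    f n = refl
seq-∏ (suc r) f n = cong (_*ℚ seq (f (suc r)) n) (seq-∏ r f n)

near-∏ : ∀ r (x y : ℕ → ℕ → ℚ) → (∀ k → Near (x k) (y k)) →
         Near (λ n → ∏ℚ r (λ k → x k n)) (λ n → ∏ℚ r (λ k → y k n))
near-∏ zero    x y p = near-const 1ℚ
near-∏ (suc r) x y p =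
  near-* (λ n → ∏ℚ r (λ k → x k n)) (λ n → ∏ℚ r (λ k → y k n)) (x (suc r)) (y (suc r))
    (near-∏ r x y p) (p (suc r))

1/suc-near-0 : Near 1/suc (λ _ → 0ℚ)
1/suc-near-0 ε 0<ε with archimedean ε 0<ε
... | M , f = M , λ i j Mi Mj → subst (_≤ℚ ε)
  (sym (trans (cong ∣_∣ (ℚ.+-identityʳ (1/suc i))) (ℚ.0≤p⇒∣p∣≡p (frac-≤ 0 0 1 i ℕ.z≤n))))
  (f i Mi)

near-affine : ∀ a b x y → Near x y → Near (λ n → a +ℚ b *ℚ x n) (λ n → a +ℚ b *ℚ y n)
near-affine a b x y p = near-+ (λ _ → a) (λ _ → a) (λ n → b *ℚ x n) (λ n → b *ℚ y n)
  (near-const a) (near-* (λ _ → b) (λ _ → b) x y (near-const b) p)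

near-+-0 : ∀ x z → Near x x → Near z (λ _ → 0ℚ) → Near (λ n → x n +ℚ z n) x
near-+-0 x z p q ε 0<ε =
  let M , f = near-+ x x z (λ _ → 0ℚ) p q ε 0<ε in M , λ i j Mi Mj →
  subst (λ q → ∣ x i +ℚ z i -ℚ q ∣ ≤ℚ ε) (ℚ.+-identityʳ (x j)) (f i j Mi Mj)

p≤∣p∣ : ∀ p → p ≤ℚ ∣ p ∣
p≤∣p∣ p with ℚ.≤-total 0ℚ p
... | inj₁ 0≤p = ℚ.≤-reflexive (sym (ℚ.0≤p⇒∣p∣≡p 0≤p))
... | inj₂ p≤0 = ℚ.≤-trans p≤0 (ℚ.0≤∣p∣ p)

∣p-q∣≤r⇒p≤q+r : ∀ {p q r} → ∣ p -ℚ q ∣ ≤ℚ r → p ≤ℚ q +ℚ r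
∣p-q∣≤r⇒p≤q+r {p} {q} {r} h = begin
  p                 ≡⟨ solve 2 (λ a b → a := b :+ (a :- b)) refl p q ⟩
  q +ℚ (p -ℚ q)     ≤⟨ ℚ.+-monoʳ-≤ q (ℚ.≤-trans (p≤∣p∣ (p -ℚ q)) h) ⟩
  q +ℚ r            ∎
  where
  open ℚ.≤-Reasoning
  open +-*-Solver

ι : ℕ → ℚ
ι n = + n ℚ./ 1

ι-≤ : ∀ {a b} → a ℕ.≤ b → ι a ≤ℚ ι b
ι-≤ {a} {b} h = frac-≤ a 0 b 0 (ℕ.*-monoˡ-≤ 1 h)

ι-suc : ∀ n → ι (suc n) ≡ ι n +ℚ 1ℚ
ι-suc n = frac-suc n 0

-- Far enough out, `y` exceeds `x` by at most ¼ and `x` exceeds `q` by at most ¼, which together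
-- stay strictly below 1.
near-bound : ∀ y x q → Near y x →
  (∀ ε → 0ℚ <ℚ ε → ∃ λ M → ∀ n → M ℕ.≤ n → x n ≤ℚ q +ℚ ε) →
  ∃ λ n → y n <ℚ q +ℚ 1ℚ
near-bound y x q near upper =
  let M₁ , f = near ¼ 0<¼
      M₂ , g = upper ¼ 0<¼
      n      = M₁ ℕ.⊔ M₂
  in n , (begin-strict
    y n               ≤⟨ ∣p-q∣≤r⇒p≤q+r (f n n (ℕ.m≤m⊔n M₁ M₂) (ℕ.m≤m⊔n M₁ M₂)) ⟩
    x n +ℚ ¼          ≤⟨ ℚ.+-monoˡ-≤ ¼ (g n (ℕ.m≤n⊔m M₁ M₂)) ⟩
    q +ℚ ¼ +ℚ ¼       ≡⟨ ℚ.+-assoc q ¼ ¼ ⟩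
    q +ℚ (¼ +ℚ ¼)     <⟨ ℚ.+-monoʳ-< q (from-yes (¼ +ℚ ¼ ℚ.<? 1ℚ)) ⟩
    q +ℚ 1ℚ           ∎)
  where
  open ℚ.≤-Reasoning
  ¼ = ½ *ℚ ½
  0<¼ = from-yes (0ℚ ℚ.<? ¼)

-- Clears the common denominator `d` of all `r` factors at once.
∏-frac : ∀ d (a : ℕ → ℕ) (q : ℕ → ℚ) → (∀ k → q k *ℚ ι d ≡ ι (a k)) →
         ∀ r → ∏ℚ r q *ℚ ι (d ℕ.^ r) ≡ ι (∏ r a)
∏-frac d a q eq zero    = refl
∏-frac d a q eq (suc r) = begin
  ∏ℚ r q *ℚ q (suc r) *ℚ ι (d ℕ.* d ℕ.^ r)
    ≡⟨ cong (∏ℚ r q *ℚ q (suc r) *ℚ_) (frac-* d 0 (d ℕ.^ r)) ⟨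
  ∏ℚ r q *ℚ q (suc r) *ℚ (ι d *ℚ ι (d ℕ.^ r))
    ≡⟨ solve 4 (λ a b c e → a :* b :* (c :* e) := a :* e :* (b :* c)) refl
         (∏ℚ r q) (q (suc r)) (ι d) (ι (d ℕ.^ r)) ⟩
  ∏ℚ r q *ℚ ι (d ℕ.^ r) *ℚ (q (suc r) *ℚ ι d)
    ≡⟨ cong₂ _*ℚ_ (∏-frac d a q eq r) (eq (suc r)) ⟩
  ι (∏ r a) *ℚ ι (a (suc r))
    ≡⟨ frac-* (∏ r a) 0 (a (suc r)) ⟩
  ι (∏ r a ℕ.* a (suc r)) ∎
  where
  open ≡-Reasoning
  open +-*-Solver

-- Rounding the roots up to a common denominator.

module _ (m : ℕ) .{{_ : NonZero m}} where

  -- The least integer greater than (n + 1) k^{1/m}.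
  root-up : ℕ → ℕ → ℕ
  root-up n k = suc (root-num m k n)

  root-up-mono : ∀ n {j k} → j ℕ.≤ k → root-up n j ℕ.≤ root-up n k
  root-up-mono n {j} {k} j≤k with root-up n j ℕ.≤? root-up n k
  ... | yes p = p
  ... | no  p = contradiction (ℕ.≤-trans (ℕ.^-monoˡ-≤ m (ℕ.≤-pred (ℕ.≰⇒> p)))
      (ℕ.≤-trans (root-num-≤ m j n) (ℕ.*-monoˡ-≤ (suc n ℕ.^ m) j≤k)))
      (ℕ.<⇒≱ (root-num-< m k n))

  private
    -- `x k` is the sequence of the k-th real factor. In `y k` the root is rounded up to
    -- `root-up n k` over `suc n`, which keeps the limit.
    x y : ℕ → ℕ → ℚ
    x k n = 1ℚ +ℚ ι 2 *ℚ root-seq m k n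
    y k n = 1ℚ +ℚ ι 2 *ℚ (root-seq m k n +ℚ 1/suc n)

    y-near-x : ∀ k → Near (y k) (x k)
    y-near-x k = near-affine 1ℚ (ι 2) (λ n → root-seq m k n +ℚ 1/suc n) (root-seq m k)
      (near-+-0 (root-seq m k) 1/suc (root-cauchy m k) 1/suc-near-0)

    y-frac : ∀ n k → y k n *ℚ ι (suc n) ≡ ι (suc n ℕ.+ 2 ℕ.* root-up n k)
    y-frac n k = begin
      (1ℚ +ℚ ι 2 *ℚ (root-seq m k n +ℚ 1/suc n)) *ℚ ι d
        ≡⟨ solve 4 (λ o t q e → (o :+ t :* q) :* e := o :* e :+ t :* (q :* e)) refl
             1ℚ (ι 2) (root-seq m k n +ℚ 1/suc n) (ι d) ⟩
      1ℚ *ℚ ι d +ℚ ι 2 *ℚ ((root-seq m k n +ℚ 1/suc n) *ℚ ι d)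
        ≡⟨ cong₂ (λ u v → u +ℚ ι 2 *ℚ v) (ℚ.*-identityˡ (ι d))
             (trans (cong (_*ℚ ι d) (sym (frac-suc (root-num m k n) n)))
               (trans (frac-* b n d) (frac-cancel b n))) ⟩
      ι d +ℚ ι 2 *ℚ ι b
        ≡⟨ cong (ι d +ℚ_) (frac-* 2 0 b) ⟩
      ι d +ℚ ι (2 ℕ.* b)
        ≡⟨ ι-+ d (2 ℕ.* b) ⟨
      ι (d ℕ.+ 2 ℕ.* b) ∎
      where
      open ≡-Reasoning
      open +-*-Solver
      d = suc n
      b = root-up n k
      ι-+ : ∀ a c → ι (a ℕ.+ c) ≡ ι a +ℚ ι c
      ι-+ zero    c = sym (ℚ.+-identityˡ (ι c))
      ι-+ (suc a) c = begin
        ι (suc (a ℕ.+ c))      ≡⟨ ι-suc (a ℕ.+ c) ⟩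
        ι (a ℕ.+ c) +ℚ 1ℚ      ≡⟨ cong (_+ℚ 1ℚ) (ι-+ a c) ⟩
        ι a +ℚ ι c +ℚ 1ℚ       ≡⟨ solve 3 (λ a c o → a :+ c :+ o := a :+ o :+ c) refl (ι a) (ι c) 1ℚ ⟩
        ι a +ℚ 1ℚ +ℚ ι c       ≡⟨ cong (_+ℚ ι c) (ι-suc a) ⟨
        ι (suc a) +ℚ ι c       ∎

  -- The hypothesis bounds the product by N, while N + 1 vertices are available. This slack of 1
  -- absorbs the rounding up of all roots once the denominator is suitably chosen.
  ∏-root-up-< : ∀ r N → fromℕ N ≥ ∏[1≤ k ≤ r ] (fromℕ 1 + fromℕ 2 * k ^1/ m) →
    ∃ λ n → ∏ r (λ k → suc n ℕ.+ 2 ℕ.* root-up n k) ℕ.< suc N ℕ.* suc n ℕ.^ r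
  ∏-root-up-< r N h =
    let n , Y< = near-bound (λ n → ∏ℚ r (λ k → y k n)) (λ n → ∏ℚ r (λ k → x k n)) (ι N)
                   (near-∏ r y x y-near-x) X≤
    in n , clear n Y<
    where
    open ℚ.≤-Reasoning
    X≤ : ∀ ε → 0ℚ <ℚ ε → ∃ λ M → ∀ n → M ℕ.≤ n → ∏ℚ r (λ k → x k n) ≤ℚ ι N +ℚ ε
    X≤ ε 0<ε = let M , f = h ε 0<ε in M , λ n Mn → subst (_≤ℚ ι N +ℚ ε)
      (seq-∏ r (λ k → fromℕ 1 + fromℕ 2 * k ^1/ m) n) (f n Mn)
    clear : ∀ n → ∏ℚ r (λ k → y k n) <ℚ ι N +ℚ 1ℚ →
            ∏ r (λ k → suc n ℕ.+ 2 ℕ.* root-up n k) ℕ.< suc N ℕ.* suc n ℕ.^ r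
    clear n Y< = ℕ.≰⇒> λ le → ℚ.<-irrefl refl (ℚ.<-≤-trans Y<
      (ℚ.*-cancelʳ-≤-pos (ι (d ℕ.^ r)) {{D>0}} (begin
        (ι N +ℚ 1ℚ) *ℚ ι (d ℕ.^ r)   ≡⟨ cong (_*ℚ ι (d ℕ.^ r)) (ι-suc N) ⟨
        ι (suc N) *ℚ ι (d ℕ.^ r)     ≡⟨ frac-* (suc N) 0 (d ℕ.^ r) ⟩
        ι (suc N ℕ.* d ℕ.^ r)        ≤⟨ ι-≤ le ⟩
        ι (∏ r (λ k → d ℕ.+ 2 ℕ.* root-up n k))
          ≡⟨ ∏-frac d (λ k → d ℕ.+ 2 ℕ.* root-up n k) (λ k → y k n) (y-frac n) r ⟨
        ∏ℚ r (λ k → y k n) *ℚ ι (d ℕ.^ r) ∎)))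
      where
      d = suc n
      D>0 = ℚ.positive (ℚ.<-≤-trans (ℚ.positive⁻¹ 1ℚ) (ι-≤ (ℕ.m^n>0 d r)))

-- Products over final segments, and finite search.

suffix-∏ : ℕ → ℕ → (ℕ → ℕ) → ℕ
suffix-∏ zero    l f = 1
suffix-∏ (suc s) l f = f (suc l) ℕ.* suffix-∏ s (suc l) f

-- `suffix-∏` sheds its lowest factor, as the weights do in `w-step`, whereas `∏` grows at the top.
-- Factors move across one at a time.
∏-suffix-∏ : ∀ s l f → ∏ l f ℕ.* suffix-∏ s l f ≡ ∏ (l ℕ.+ s) f
∏-suffix-∏ zero    l f = trans (ℕ.*-identityʳ (∏ l f)) (cong (λ t → ∏ t f) (sym (ℕ.+-identityʳ l)))
∏-suffix-∏ (suc s) l f = trans (sym (ℕ.*-assoc (∏ l f) (f (suc l)) (suffix-∏ s (suc l) f)))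
  (trans (∏-suffix-∏ s (suc l) f) (cong (λ t → ∏ t f) (sym (ℕ.+-suc l s))))

sum-const : ∀ n x → sum {n} (λ _ → x) ≡ n ℕ.* x
sum-const zero    x = refl
sum-const (suc n) x = cong (x ℕ.+_) (sum-const n x)

-- Functions are rebuilt from their values and recovered only pointwise, hence the condition that
-- `P` respects `≗`.
any-function? : ∀ n {N} {P : (Fin n → Fin N) → Set} → (∀ {f g} → f ≗ g → P f → P g) →
                Decidable P → Dec (∃ P)
any-function? zero    resp P? = map′ (λ p → [] , p) (λ (f , p) → resp (λ ()) p) (P? [])
any-function? (suc n) {N} {P} resp P? = map′
  (λ (a , f , p) → a ∷ f , p)
  (λ (f , p) → f zero , (λ i → f (suc i)) , resp (λ { zero → refl ; (suc i) → refl }) p)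
  (any? (λ a → any-function? n (λ f≗g → resp (λ { zero → refl ; (suc i) → f≗g i }))
                               (λ f → P? (a ∷ f))))

-- Decidability makes the argument by contradiction in `∏≥⇒solution` constructive.
hasMonochromaticSolution? : ∀ {N r} m (φ : Coloring N r) → Dec (HasMonochromaticSolution m φ)
hasMonochromaticSolution? m φ =
  any-function? (suc m)
    (λ { f≗g (y , s , c , px , py) →
         y , trans (sum-cong-≗ (λ i → cong value (sym (f≗g i)))) s ,
         c , (λ i → trans (cong φ (sym (f≗g i))) (px i)) , py })
    (λ x → any-function? m
      (λ { f≗g (s , c , px , py) →
           trans s (sum-cong-≗ (λ j → cong value (f≗g j))) ,
           c , px , (λ j → trans (cong φ (sym (f≗g j))) (py j)) })
      (λ y → (sum (λ i → value (x i)) ℕ.≟ sum (λ j → value (y j))) ×-dec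
             any? (λ c → all? (λ i → φ (x i) Fin.≟ c) ×-dec all? (λ j → φ (y j) Fin.≟ c))))

-- The vertices are the integers 0, …, N; an edge from x to y has the colour of y − x.
module DifferenceGraph {N r : ℕ} (φ : Coloring N r) where

  Edge : Fin r → Fin (suc N) → Fin (suc N) → Set
  Edge c x y = ∃ λ a → toℕ x ℕ.+ value a ≡ toℕ y × φ a ≡ c

  edge? : ∀ c x y → Dec (Edge c x y)
  edge? c x y = any? (λ a → (toℕ x ℕ.+ value a ℕ.≟ toℕ y) ×-dec (φ a Fin.≟ c))

  <⇒edge : ∀ {x y} → toℕ x ℕ.< toℕ y → ∃ λ c → Edge c x y
  <⇒edge {x} {y} x<y with ℕ.m≤n⇒∃[o]m+o≡n x<y
  -- Here k = y - x - 1 is the index whose value is y - x; it is below N because y ≤ N.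
  ... | k , eq = φ a , a , trans (ℕ.+-suc (toℕ x) (toℕ a))
                       (trans (cong (λ t → suc (toℕ x ℕ.+ t)) (Fin.toℕ-fromℕ< k<N)) eq) , refl
    where
    k<N : k ℕ.< N
    k<N = ℕ.<-≤-trans (ℕ.≤-trans (ℕ.s≤s (ℕ.m≤n+m k (toℕ x))) (ℕ.≤-reflexive eq)) (Fin.toℕ≤pred[n] y)
    a = fromℕ< k<N

  edge-total : ∀ {x y} → x ≢ y → ∃ λ c → Edge c x y ⊎ Edge c y x
  edge-total {x} {y} x≢y with ℕ.<-cmp (toℕ x) (toℕ y)
  ... | tri< x<y _ _ = let c , e = <⇒edge x<y in c , inj₁ e
  ... | tri≈ _ x≡y _ = contradiction (Fin.toℕ-injective x≡y) x≢y
  ... | tri> _ _ y<x = let c , e = <⇒edge y<x in c , inj₂ e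

  Σvalue : ∀ {i} → (Fin i → Fin N) → ℕ
  Σvalue f = sum (λ j → value (f j))

  -- Holds for the endpoints of two walks in colour c from a common vertex
  -- that make the same i forward and backward steps.
  Twin : ℕ → Fin r → Fin (suc N) → Fin (suc N) → Set
  Twin i c u v = ∃₂ λ (f g : Fin i → Fin N) →
    (∀ j → φ (f j) ≡ c) × (∀ j → φ (g j) ≡ c) × toℕ u ℕ.+ Σvalue f ≡ toℕ v ℕ.+ Σvalue g

  twin-refl : ∀ {c v} → Twin 0 c v v
  twin-refl = (λ ()) , (λ ()) , (λ ()) , (λ ()) , refl

  mono-∷ : ∀ {i c a} {f : Fin i → Fin N} → φ a ≡ c → (∀ j → φ (f j) ≡ c) → ∀ j → φ ((a ∷ f) j) ≡ c
  mono-∷ pa pf zero    = pa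
  mono-∷ pa pf (suc j) = pf j

  private
    shift : ∀ u v a b p q → u ℕ.+ p ≡ v ℕ.+ q →
            u ℕ.+ a ℕ.+ (b ℕ.+ p) ≡ v ℕ.+ b ℕ.+ (a ℕ.+ q)
    shift u v a b p q eq = trans (l u a b p) (trans (cong (λ t → a ℕ.+ b ℕ.+ t) eq) (r′ v a b q))
      where
      l : ∀ u a b p → u ℕ.+ a ℕ.+ (b ℕ.+ p) ≡ a ℕ.+ b ℕ.+ (u ℕ.+ p)
      l = solve-∀
      r′ : ∀ v a b q → a ℕ.+ b ℕ.+ (v ℕ.+ q) ≡ v ℕ.+ b ℕ.+ (a ℕ.+ q)
      r′ = solve-∀

  -- From x = u + a and y = v + b, adding a + b to both sides of the old equation leaves b on the
  -- side of x and a on the side of y. For `twin-in` the two stay on their own sides.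
  twin-out : ∀ {i c u v x y} → Twin i c u v → Edge c u x → Edge c v y → Twin (suc i) c x y
  twin-out {u = u} {v} (f , g , pf , pg , eq) (a , ax , pa) (b , by , pb) =
    b ∷ f , a ∷ g , mono-∷ pb pf , mono-∷ pa pg ,
    subst₂ (λ x y → x ℕ.+ Σvalue (b ∷ f) ≡ y ℕ.+ Σvalue (a ∷ g)) ax by
      (shift (toℕ u) (toℕ v) (value a) (value b) (Σvalue f) (Σvalue g) eq)

  twin-in : ∀ {i c u v x y} → Twin i c u v → Edge c x u → Edge c y v → Twin (suc i) c x y
  twin-in {x = x} {y} (f , g , pf , pg , eq) (a , ax , pa) (b , by , pb) =
    a ∷ f , b ∷ g , mono-∷ pa pf , mono-∷ pb pg ,
    trans (sym (ℕ.+-assoc (toℕ x) (value a) (Σvalue f)))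
      (trans (cong (ℕ._+ Σvalue f) ax)
        (trans eq (trans (cong (ℕ._+ Σvalue g) (sym by)) (ℕ.+-assoc (toℕ y) (value b) (Σvalue g)))))

  -- The same summand goes on both sides; this brings shorter walks up to exactly m summands.
  twin-pad : ∀ {i c u v} a → φ a ≡ c → ∀ o → Twin i c u v → Twin (o ℕ.+ i) c u v
  twin-pad a pa zero    t = t
  twin-pad {u = u} {v} a pa (suc o) t with twin-pad {u = u} {v} a pa o t
  ... | f , g , pf , pg , eq = a ∷ f , a ∷ g , mono-∷ pa pf , mono-∷ pa pg ,
    trans (swap (toℕ u) (value a) (Σvalue f))
      (trans (cong (value a ℕ.+_) eq) (sym (swap (toℕ v) (value a) (Σvalue g))))
    where
    swap : ∀ u a p → u ℕ.+ (a ℕ.+ p) ≡ a ℕ.+ (u ℕ.+ p)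
    swap = solve-∀

  -- Substituting v = u + a into u + Σf = v + Σg and cancelling u leaves a + Σg = Σf. The value of
  -- the edge has colour `c`, so it also serves as padding.
  twin-edge⇒solution : ∀ {i m c u v} → i ℕ.≤ m → Twin i c u v → Edge c u v →
                       HasMonochromaticSolution m φ
  twin-edge⇒solution {i} {c = c} {u} {v} i≤m t (a , a≡ , pa) with ℕ.m≤n⇒∃[o]m+o≡n i≤m
  ... | o , refl with subst (λ j → Twin j c u v) (ℕ.+-comm o i) (twin-pad a pa o t)
  ... | f , g , pf , pg , eq = a ∷ g , f ,
    ℕ.+-cancelˡ-≡ (toℕ u) _ _ (trans (sym (ℕ.+-assoc (toℕ u) (value a) (Σvalue g)))
      (trans (cong (ℕ._+ Σvalue g) a≡) (sym eq))) ,
    c , mono-∷ pa pg , pf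

-- From the weight bound to the theorem.

∏≥⇒solution : ∀ {N r m-1} (φ : Coloring N r) d .{{_ : NonZero d}} (b : ℕ → ℕ) →
  (∀ k → NonZero (b k)) → (∀ {j k} → j ℕ.≤ k → b j ℕ.≤ b k) →
  (∀ k → k ℕ.* d ℕ.^ suc m-1 ℕ.≤ b k ℕ.^ suc m-1) →
  ∏ r (λ k → d ℕ.+ 2 ℕ.* b k) ℕ.< suc N ℕ.* d ℕ.^ r →
  HasMonochromaticSolution (suc m-1) φ
∏≥⇒solution {N} {r} {m-1} φ d b b-nonZero b-mono b-pow ∏< =
  decidable-stable (hasMonochromaticSolution? (suc m-1) φ) λ unsolvable →
    ℕ.<⇒≱ ∏< (bound unsolvable)
  where
  open DifferenceGraph φ
  F : ℕ → ℕ
  F k = d ℕ.+ 2 ℕ.* b k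
  -- For l ≤ r this is d^r ∏_{l < j ≤ r} (1 + 2 b_j / d), an integer because only r - l factors
  -- carry the denominator d.
  w : ℕ → ℕ
  w l = d ℕ.^ l ℕ.* suffix-∏ (r ℕ.∸ l) l F
  w-step : ∀ {l} → l ℕ.< r → d ℕ.* w l ≡ F (suc l) ℕ.* w (suc l)
  w-step {l} l<r = trans
    (cong (λ s → d ℕ.* (d ℕ.^ l ℕ.* suffix-∏ s l F)) (ℕ.+-∸-assoc 1 l<r))
    (regroup d (d ℕ.^ l) (F (suc l)) (suffix-∏ (r ℕ.∸ suc l) (suc l) F))
    where
    regroup : ∀ d p x q → d ℕ.* (p ℕ.* (x ℕ.* q)) ≡ x ℕ.* (d ℕ.* p ℕ.* q)
    regroup = solve-∀
  w-0 : w 0 ≡ ∏ r F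
  w-0 = trans (ℕ.*-identityˡ _) (trans (sym (ℕ.*-identityˡ _)) (∏-suffix-∏ r 0 F))
  w-r : w r ≡ d ℕ.^ r
  w-r = trans (cong (λ s → d ℕ.^ r ℕ.* suffix-∏ s r F) (ℕ.n∸n≡0 r)) (ℕ.*-identityʳ _)
  bound : ¬ HasMonochromaticSolution (suc m-1) φ → suc N ℕ.* d ℕ.^ r ℕ.≤ ∏ r F
  bound unsolvable = begin
    suc N ℕ.* d ℕ.^ r         ≡⟨ cong (suc N ℕ.*_) w-r ⟨
    suc N ℕ.* w r             ≡⟨ cong (λ t → suc N ℕ.* w t) (∣⊤∣≡n r) ⟨
    suc N ℕ.* w Subset.∣ full ∣         ≡⟨ sum-const (suc N) (w Subset.∣ full ∣) ⟨
    -- With all `r` colours live at all N + 1 vertices, validity is immediate and each vertex weighs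
    -- `w r`, that is d^r.
    weight every? (λ _ → full)   ≤⟨ weight-≤ _ every? (λ _ → full) (λ _ _ _ → ∈⊤ , ∈⊤) ℕ.≤-refl ⟩
    w 0                       ≡⟨ w-0 ⟩
    ∏ r F                     ∎
    where
    open ℕ.≤-Reasoning
    open Weights Edge edge? edge-total Twin (λ {c} {v} → twin-refl {c} {v})
      (λ {i} {c} {u} {v} {x} {y} → twin-out {i} {c} {u} {v} {x} {y})
      (λ {i} {c} {u} {v} {x} {y} → twin-in {i} {c} {u} {v} {x} {y})
      (λ i≤m t e → unsolvable (twin-edge⇒solution i≤m t e))
      d b w b-nonZero b-mono b-pow w-step
    full : Subset.Subset r
    full = ⊤
    every? : Decidable {A = Fin (suc N)} (λ _ → Unit)
    every? _ = yes tt

theorem1 : (r m N : ℕ) .{{_ : NonZero r}} .{{_ : NonZero m}} .{{_ : NonZero N}} →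
    fromℕ N ≥ ∏[1≤ k ≤ r ] (fromℕ 1 + fromℕ 2 * k ^1/ m) →
    (φ : Coloring N r) →
    HasMonochromaticSolution m φ
theorem1 r m@(suc m-1) N {{_}} {{m≢0}} h φ = solve (∏-root-up-< m {{m≢0}} r N h)
  where
  solve : (∃ λ n → ∏ r (λ k → suc n ℕ.+ 2 ℕ.* root-up m n k) ℕ.< suc N ℕ.* suc n ℕ.^ r) →
          HasMonochromaticSolution m φ
  -- The common denominator d is n + 1, for the index n at which the rounded product is below N + 1.
  solve (n , ∏<) = ∏≥⇒solution φ (suc n) (root-up m n) (λ _ → _) (root-up-mono m n)
                     (λ k → ℕ.<⇒≤ (root-num-< m k n)) ∏<
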